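{- Every simple planar $2$-connected cubic graph on $n > 4$ vertices has a cycle double cover of size at most $n/2$.
   Context: A cycle is a connected $2$-regular graph. A cycle double cover of a graph $G$ is a multiset of cycles of $G$ such that every edge of $G$ lies in exactly two members, counted with multiplicity; its size is the number of cycles counted with multiplicity. -}

module Defs where

open import Data.Nat using (ℕ; zero; suc; _+_; _*_; _≤_; _<_; _≤ᵇ_; _<ᵇ_)
open import Data.Bool using (Bool; true; false; if_then_else_; _∧_; T)
open import Data.Fin using (Fin; toℕ) renaming (zero to fzero; suc to fsuc)
open import Data.Product using (_×_; _,_; Σ; ∃)
open import Data.Sum using (_⊎_)
open import Data.List using (List; []; _∷_; length)
open import Relation.Binary.PropositionalEquality using (_≡_; _≢_)
open import Function using (_∘_)

sumF : ∀ {n} → (Fin n → ℕ) → ℕ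
sumF {zero}  f = 0
sumF {suc n} f = f fzero + sumF (f ∘ fsuc)

countF : ∀ {n} → (Fin n → Bool) → ℕ
countF p = sumF (λ i → if p i then 1 else 0)

allF : ∀ {n} → (Fin n → Bool) → Bool
allF {zero}  p = true
allF {suc n} p = p fzero ∧ allF (p ∘ fsuc)

iter : ∀ {A : Set} → (A → A) → ℕ → A → A
iter f zero    x = x
iter f (suc k) x = f (iter f k x)

record SimpleGraph (n : ℕ) : Set where
  field
    adj       : Fin n → Fin n → Bool
    irrefl    : ∀ v → adj v v ≡ false
    symmetric : ∀ u v → adj u v ≡ adj v u
open SimpleGraph public

degreeIn : ∀ {n} → (Fin n → Fin n → Bool) → Fin n → ℕ
degreeIn E v = countF (E v)

degree : ∀ {n} → SimpleGraph n → Fin n → ℕ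
degree G = degreeIn (adj G)

numEdges : ∀ {n} → SimpleGraph n → ℕ
numEdges G = sumF (λ u → countF (λ v → adj G u v ∧ (toℕ u <ᵇ toℕ v)))

Cubic : ∀ {n} → SimpleGraph n → Set
Cubic G = ∀ v → degree G v ≡ 3

data ReachIn {n : ℕ} (P : Fin n → Bool) (E : Fin n → Fin n → Bool)
     : Fin n → Fin n → Set where
  here : ∀ {u} → T (P u) → ReachIn P E u u
  step : ∀ {u w v} → T (P u) → T (E u w) → ReachIn P E w v → ReachIn P E u v

everywhere : ∀ {n} → Fin n → Bool
everywhere _ = true

Connected : ∀ {n} → SimpleGraph n → Set
Connected G = ∀ u v → ReachIn everywhere (adj G) u v

avoid : ∀ {n} → Fin n → Fin n → Bool
avoid x w = if toℕ w Data.Nat.≡ᵇ toℕ x then false else true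

TwoConnected : ∀ {n} → SimpleGraph n → Set
TwoConnected {n} G =
  2 < n × (∀ x u v → u ≢ x → v ≢ x → ReachIn (avoid x) (adj G) u v)

-- Planarity, via combinatorial embeddings (rotation systems) of genus 0

-- ρ v u = successor of the neighbour u in the cyclic order around v
record RotationSystem {n : ℕ} (G : SimpleGraph n) : Set where
  field
    rot        : Fin n → Fin n → Fin n
    rot-nbr    : ∀ v u → T (adj G v u) → T (adj G v (rot v u))
    rot-inj    : ∀ v u w → T (adj G v u) → T (adj G v w) →
                 rot v u ≡ rot v w → u ≡ w
    rot-cyclic : ∀ v u w → T (adj G v u) → T (adj G v w) →
                 ∃ λ k → iter (rot v) k u ≡ w
open RotationSystem public

Dart : ℕ → Set
Dart n = Fin n × Fin n

-- face-tracing permutation on darts: arrive at v along (u,v), leave along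
-- the next edge after vu in the rotation at v
facePerm : ∀ {n} {G : SimpleGraph n} → RotationSystem G → Dart n → Dart n
facePerm R (u , v) = (v , rot R v u)

dartCode : ∀ {n} → Dart n → ℕ
dartCode {n} (u , v) = toℕ u * n + toℕ v

-- d is the least dart of its face-orbit (orbits have length ≤ n*n)
leastInOrbit : ∀ {n} {G : SimpleGraph n} → RotationSystem G → Dart n → Bool
leastInOrbit {n} R d =
  allF {n * n} (λ k → dartCode d ≤ᵇ dartCode (iter (facePerm R) (toℕ k) d))

numFaces : ∀ {n} {G : SimpleGraph n} → RotationSystem G → ℕ
numFaces {n} {G} R =
  sumF (λ u → countF (λ v → adj G u v ∧ leastInOrbit R (u , v)))

-- planar: some rotation system satisfies Euler's formula V - E + F = 2
Planar : ∀ {n} → SimpleGraph n → Set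
Planar {n} G = Σ (RotationSystem G) λ R → n + numFaces R ≡ 2 + numEdges G

-- a cycle of G: a nonempty connected 2-regular subgraph, given by its
-- edge set; its vertices are the vertices of positive degree
record Cycle {n : ℕ} (G : SimpleGraph n) : Set where
  field
    cedge      : Fin n → Fin n → Bool
    csym       : ∀ u v → cedge u v ≡ cedge v u
    csub       : ∀ u v → T (cedge u v) → T (adj G u v)
    cdeg       : ∀ v → degreeIn cedge v ≡ 0 ⊎ degreeIn cedge v ≡ 2
    cnonempty  : ∃ λ v → degreeIn cedge v ≡ 2
    cconnected : ∀ u v → degreeIn cedge u ≡ 2 → degreeIn cedge v ≡ 2 →
                 ReachIn (λ w → 0 <ᵇ degreeIn cedge w) cedge u v
open Cycle public

edgeMult : ∀ {n} {G : SimpleGraph n} → List (Cycle G) → Fin n → Fin n → ℕ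
edgeMult []       u v = 0
edgeMult (C ∷ cs) u v = (if cedge C u v then 1 else 0) + edgeMult cs u v

IsCycleDoubleCover : ∀ {n} {G : SimpleGraph n} → List (Cycle G) → Set
IsCycleDoubleCover {G = G} cs = ∀ u v → T (adj G u v) → edgeMult cs u v ≡ 2

{-# OPTIONS --safe #-}
-- A planar cubic graph has n/2 + 2 faces, and by 2-connectivity each face is
-- bounded by a cycle, so the faces form a double cover with two cycles too many.
-- Let A be a face sharing at most one edge with every other face (a free face).
-- Its neighbours form an outerplanar graph in the dual, hence can be 3-coloured;
-- replacing A and its neighbours by the three cycles bounding A together with
-- one colour class gives a double cover again, saving two cycles or more as soon
-- as A has at least four edges.  If every face is free, such an A exists because
-- G is not K₄.  If two faces share two edges, these edges form a cut, and both
-- sides contain a free face; when both are triangles, cutting them up among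
-- their neighbours saves one cycle each.
--
-- The topology enters only through one fact derived from Euler's formula by
-- linear algebra over the field with two elements: a closed walk in the dual
-- graph crosses the edges of a cut of G.
module Submission where

open import Defs
open import Algebra using (CommutativeRing)
open import Algebra.Structures using (IsCommutativeMonoid)
open import Data.Bool using (Bool; T; _xor_; _∧_; _∨_; false; if_then_else_; not; true)
open import Data.Bool.Properties using (T-≡; T?; xor-assoc; xor-comm; xor-identityʳ; xor-same; xor-∧-commutativeRing; ∧-comm; ∧-conicalʳ; ∧-conicalˡ; ∧-distribʳ-xor; ∧-identityʳ; ∧-zeroʳ; ∨-comm; ∨-identityʳ; ∨-zeroʳ) renaming (_≟_ to _≟ᵇ_)
open import Data.Empty using (⊥; ⊥-elim)
open import Data.Fin using (Fin; combine; fromℕ<; punchIn; punchOut; suc; toℕ; zero)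
open import Data.Fin.Properties using (_≟_; any?; combine-injective; pigeonhole; punchInᵢ≢i; punchOut-cong; punchOut-punchIn; toℕ-combine; toℕ-fromℕ<; toℕ-injective; toℕ<n)
open import Data.List using (List; []; _++_; _∷_; allFin; cartesianProduct; filter; foldr; length; lookup; map; tabulate)
open import Data.List.Membership.DecPropositional using (_∈?_)
open import Data.List.Membership.Propositional using (_∈_; _∉_)
open import Data.List.Membership.Propositional.Properties using (∈-++⁺ʳ; ∈-++⁺ˡ; ∈-++⁻; ∈-allFin; ∈-cartesianProduct⁺; ∈-filter⁺; ∈-filter⁻; ∈-lookup)
open import Data.List.Properties using (++-assoc; filter-++; length-++)
open import Data.List.Relation.Unary.All as All using (All; []; _∷_)
open import Data.List.Relation.Unary.AllPairs using ([]; _∷_)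
open import Data.List.Relation.Unary.Any using (here; index; there)
import Data.List.Relation.Unary.Any.Properties as Any
open import Data.List.Relation.Unary.Unique.Propositional using (Unique)
open import Data.List.Relation.Unary.Unique.Propositional.Properties using (allFin⁺; cartesianProduct⁺; filter⁺)
open import Data.Nat using (_%_; _*_; _+_; _/_; _<_; _<ᵇ_; _∸_; _≡ᵇ_; _≤?_; _≤_; _≤ᵇ_; suc; s≤s; s≤s⁻¹; zero; z≤n; ℕ)
open import Data.Nat.DivMod using (m%n<n; m≡m%n+[m/n]*n)
open import Data.Nat.Properties using (*-comm; *-distribˡ-+; *-identityʳ; *-monoʳ-≤; +-0-isCommutativeMonoid; +-cancelʳ-≡; +-cancelˡ-≡; +-cancelˡ-≤; +-comm; +-identityʳ; +-mono-≤; +-monoʳ-≤; +-monoˡ-≤; +-suc; <-asym; <-cmp; <-irrefl; <-trans; <-≤-trans; <ᵇ⇒<; <⇒<ᵇ; <⇒≢; <⇒≤; <⇒≱; m<n⇒0<n∸m; module ≤-Reasoning; m∸n+n≡m; m∸n≤m; m≤m*n; m≤m+n; m≤n+m; m≤n⇒m<n∨m≡n; m≤n⇒m≤1+n; n<1+n; ≡⇒≡ᵇ; ≤-<-connex; ≤-<-trans; ≤-antisym; ≤-refl; ≤-reflexive; ≤-total; ≤-trans; ≤ᵇ⇒≤; ≤⇒≤ᵇ)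
open import Data.Nat.Tactic.RingSolver using (solve-∀)
open import Data.Product using (_,_; _×_; proj₁; proj₂; uncurry; Σ; ∃; ∃₂)
open import Data.Product.Properties using (≡-dec)
open import Data.Sum using ([_,_]′; _⊎_; inj₁; inj₂)
open import Data.Unit using (tt; ⊤)
open import Function using (Equivalence; _∘_; id; mk⇔)
open import Relation.Binary using (IsEquivalence)
import Relation.Binary.Construct.On as On
open import Relation.Binary.Definitions using (tri<; tri>; tri≈)
open import Relation.Binary.PropositionalEquality
open import Relation.Nullary using (Dec; _×-dec_; contradiction; does; no; yes; ¬?; ¬_)
open import Relation.Nullary.Decidable using (dec-false; dec-true; does-⇔)

-- Sums and counts over Fin

-- Cycles are never traced as vertex sequences: each is the boundary modulo 2 of a set of faces.
-- Three faces meet at every vertex of a cubic graph, so such a boundary has degree 0 or 2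
-- everywhere, and only its connectedness needs an argument. For `A` with one colour class it holds
-- because the faces of the class are glued to `A` along one edge each and to each other nowhere. A
-- free face of length k and its k neighbours, k + 1 faces in all, turn into three cycles, which
-- saves k - 2; this is why triangles need a construction of their own and why these come in pairs.
-- Planarity is given as a mere equation between numbers, so the separating power of closed curves
-- has to be extracted by a rank count. Outside a spanning tree of the dual there remain n - 1
-- edges, just enough for the coboundaries of G to take arbitrary values on them; hence every edge
-- set orthogonal to all boundaries of sets of faces is a cut. That an edge has two different sides,
-- that two faces sharing two edges disconnect the graph, and that chords around a free face do not
-- cross are all read off from this.

module FinSum {A : Set} (_∙_ : A → A → A) (ε : A) (cm : IsCommutativeMonoid _≡_ _∙_ ε) where
  open IsCommutativeMonoid cm using (assoc; comm; identityˡ; identityʳ)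
  open ≡-Reasoning

  ∑ : ∀ {n} → (Fin n → A) → A
  ∑ {zero}  f = ε
  ∑ {suc n} f = f zero ∙ ∑ (f ∘ suc)

  ∑-cong : ∀ {n} {f g : Fin n → A} → (∀ i → f i ≡ g i) → ∑ f ≡ ∑ g
  ∑-cong {zero}  eq = refl
  ∑-cong {suc n} eq = cong₂ _∙_ (eq zero) (∑-cong (eq ∘ suc))

  ∑-ε : ∀ {n} {f : Fin n → A} → (∀ i → f i ≡ ε) → ∑ f ≡ ε
  ∑-ε {zero}  eq = refl
  ∑-ε {suc n} eq = trans (cong₂ _∙_ (eq zero) (∑-ε (eq ∘ suc))) (identityˡ ε)

  interchange : ∀ a b c d → (a ∙ b) ∙ (c ∙ d) ≡ (a ∙ c) ∙ (b ∙ d)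
  interchange a b c d = begin
    (a ∙ b) ∙ (c ∙ d) ≡⟨ assoc a b (c ∙ d) ⟩
    a ∙ (b ∙ (c ∙ d)) ≡⟨ cong (a ∙_) (assoc b c d) ⟨
    a ∙ ((b ∙ c) ∙ d) ≡⟨ cong (λ z → a ∙ (z ∙ d)) (comm b c) ⟩
    a ∙ ((c ∙ b) ∙ d) ≡⟨ cong (a ∙_) (assoc c b d) ⟩
    a ∙ (c ∙ (b ∙ d)) ≡⟨ assoc a c (b ∙ d) ⟨
    (a ∙ c) ∙ (b ∙ d) ∎

  ∑-∙ : ∀ {n} (f g : Fin n → A) → ∑ (λ i → f i ∙ g i) ≡ ∑ f ∙ ∑ g
  ∑-∙ {zero}  f g = sym (identityˡ ε)
  ∑-∙ {suc n} f g = trans (cong ((f zero ∙ g zero) ∙_) (∑-∙ (f ∘ suc) (g ∘ suc)))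
                          (interchange _ _ _ _)

  ∑-swap : ∀ {m n} (f : Fin m → Fin n → A) →
           ∑ (λ i → ∑ (f i)) ≡ ∑ (λ j → ∑ (λ i → f i j))
  ∑-swap {zero} {n} f = sym (∑-ε {n} (λ _ → refl))
  ∑-swap {suc m} f = trans (cong (∑ (f zero) ∙_) (∑-swap (f ∘ suc)))
                           (sym (∑-∙ (f zero) _))

  without : ∀ {n} → Fin n → (Fin n → A) → Fin n → A
  without i f j = if does (j ≟ i) then ε else f j

  without-≢ : ∀ {n} {i : Fin n} f {j} → j ≢ i → without i f j ≡ f j
  without-≢ {i = i} f {j} j≢i with j ≟ i
  ... | yes j≡i = contradiction j≡i j≢i
  ... | no _    = refl

  ∑-pull : ∀ {n} (i : Fin n) (f : Fin n → A) → ∑ f ≡ f i ∙ ∑ (without i f)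
  ∑-pull {suc n} zero f = cong (f zero ∙_) (sym (identityˡ _))
  ∑-pull {suc n} (suc i) f = begin
    f zero ∙ ∑ (f ∘ suc)                            ≡⟨ cong (f zero ∙_) (∑-pull i (f ∘ suc)) ⟩
    f zero ∙ (f (suc i) ∙ ∑ (without i (f ∘ suc)))   ≡⟨ assoc _ _ _ ⟨
    (f zero ∙ f (suc i)) ∙ ∑ (without i (f ∘ suc))   ≡⟨ cong₂ _∙_ (comm _ _) (∑-cong same) ⟩
    (f (suc i) ∙ f zero) ∙ ∑ (without (suc i) f ∘ suc) ≡⟨ assoc _ _ _ ⟩
    f (suc i) ∙ (f zero ∙ ∑ (without (suc i) f ∘ suc)) ∎
    where
    same : ∀ j → without i (f ∘ suc) j ≡ without (suc i) f (suc j)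
    same j with j ≟ i
    ... | yes _ = refl
    ... | no _  = refl

  -- Used to reduce a sum over all vertices to the three neighbours of a cubic vertex.
  ∑-support : ∀ {n} {f : Fin n → A} {xs} → Unique xs → (∀ i → i ∉ xs → f i ≡ ε) →
              ∑ f ≡ foldr _∙_ ε (map f xs)
  ∑-support {xs = []} _ off = ∑-ε (λ i → off i (λ ()))
  ∑-support {n} {f = f} {xs = x ∷ xs} (x∉ ∷ uniq) off = begin
    ∑ f                                        ≡⟨ ∑-pull x f ⟩
    f x ∙ ∑ (without x f)                      ≡⟨ cong (f x ∙_) (∑-support uniq off′) ⟩
    f x ∙ foldr _∙_ ε (map (without x f) xs)   ≡⟨ cong (f x ∙_) (fold-same xs x∉) ⟩
    f x ∙ foldr _∙_ ε (map f xs)               ∎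
    where
    off′ : ∀ i → i ∉ xs → without x f i ≡ ε
    off′ i i∉ with i ≟ x
    ... | yes _  = refl
    ... | no i≢x = off i λ { (here i≡x) → i≢x i≡x ; (there i∈) → i∉ i∈ }
    fold-same : ∀ ys → All (x ≢_) ys →
                foldr _∙_ ε (map (without x f) ys) ≡ foldr _∙_ ε (map f ys)
    fold-same []       []         = refl
    fold-same (y ∷ ys) (x≢y ∷ x≢ys) =
      cong₂ _∙_ (without-≢ f (≢-sym x≢y)) (fold-same ys x≢ys)

module ℕΣ = FinSum _+_ 0 +-0-isCommutativeMonoid
module ⊕ = FinSum _xor_ false (CommutativeRing.+-isCommutativeMonoid xor-∧-commutativeRing)

indicator : Bool → ℕ
indicator b = if b then 1 else 0

sumF-∑ : ∀ {n} (f : Fin n → ℕ) → sumF f ≡ ℕΣ.∑ f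
sumF-∑ {zero}  f = refl
sumF-∑ {suc n} f = cong (f zero +_) (sumF-∑ (f ∘ suc))

sumF-mono : ∀ {n} {f g : Fin n → ℕ} → (∀ i → f i ≤ g i) → sumF f ≤ sumF g
sumF-mono {zero}  f≤g = z≤n
sumF-mono {suc n} f≤g = +-mono-≤ (f≤g zero) (sumF-mono (f≤g ∘ suc))

countF-exact : ∀ {n} {p : Fin n → Bool} {xs} → Unique xs →
               (∀ i → p i ≡ true → i ∈ xs) → All (λ i → p i ≡ true) xs →
               countF p ≡ length xs
countF-exact {n} {p} {xs} uniq cover holds = begin
  countF p                                     ≡⟨ sumF-∑ (indicator ∘ p) ⟩
  ℕΣ.∑ (indicator ∘ p)                         ≡⟨ ℕΣ.∑-support uniq off ⟩
  foldr _+_ 0 (map (indicator ∘ p) xs)         ≡⟨ ones xs holds ⟩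
  length xs                                    ∎
  where
  open ≡-Reasoning
  off : ∀ i → i ∉ xs → indicator (p i) ≡ 0
  off i i∉ with p i in eq
  ... | true  = contradiction (cover i eq) i∉
  ... | false = refl
  ones : ∀ ys → All (λ i → p i ≡ true) ys → foldr _+_ 0 (map (indicator ∘ p) ys) ≡ length ys
  ones []       []         = refl
  ones (y ∷ ys) (py ∷ pys) = cong₂ _+_ (cong indicator py) (ones ys pys)

countF-mono : ∀ {n} {p q : Fin n → Bool} → (∀ i → p i ≡ true → q i ≡ true) → countF p ≤ countF q
countF-mono {p = p} {q} p⇒q = sumF-mono le
  where
  le : ∀ i → indicator (p i) ≤ indicator (q i)
  le i with p i in eq
  ... | false = z≤n
  ... | true rewrite p⇒q i eq = ≤-refl

countF-unique : ∀ {n} {p : Fin n → Bool} {xs} → Unique xs → All (λ i → p i ≡ true) xs →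
                length xs ≤ countF p
countF-unique {n} {p} {xs} uniq holds = begin
  length xs     ≡⟨ countF-exact uniq member⁻ (All.tabulate member⁺) ⟨
  countF member ≤⟨ countF-mono (λ i → All.lookup holds ∘ member⁻ i) ⟩
  countF p      ∎
  where
  open ≤-Reasoning
  member : Fin n → Bool
  member i = does (_∈?_ _≟_ i xs)
  member⁻ : ∀ i → member i ≡ true → i ∈ xs
  member⁻ i eq with _∈?_ _≟_ i xs
  ... | yes i∈ = i∈
  member⁺ : ∀ {i} → i ∈ xs → member i ≡ true
  member⁺ {i} i∈ with _∈?_ _≟_ i xs
  ... | yes _ = refl
  ... | no i∉ = contradiction i∈ i∉

countF-strict : ∀ {n} {p q : Fin n → Bool} (a : Fin n) → (∀ i → p i ≡ true → q i ≡ true) →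
                p a ≡ false → q a ≡ true → countF p < countF q
countF-strict {p = p} {q} a p⇒q ¬pa qa = begin-strict
  countF p                                       <⟨ s≤s (sumF-mono le) ⟩
  1 + sumF (ℕΣ.without a (indicator ∘ q))         ≡⟨ cong₂ _+_ (cong indicator (sym qa)) (sumF-∑ (ℕΣ.without a (indicator ∘ q))) ⟩
  indicator (q a) + ℕΣ.∑ (ℕΣ.without a (indicator ∘ q)) ≡⟨ ℕΣ.∑-pull a _ ⟨
  ℕΣ.∑ (indicator ∘ q)                           ≡⟨ sumF-∑ (indicator ∘ q) ⟨
  countF q                                       ∎
  where
  open ≤-Reasoning
  le : ∀ i → indicator (p i) ≤ ℕΣ.without a (indicator ∘ q) i
  le i with i ≟ a
  ... | yes refl rewrite ¬pa = z≤n
  ... | no _ with p i in eq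
  ...   | false = z≤n
  ...   | true rewrite p⇒q i eq = ≤-refl

countF-not : ∀ {n} (p : Fin n → Bool) → countF p + countF (not ∘ p) ≡ n
countF-not {zero}  p = refl
countF-not {suc n} p with p zero
... | true  = cong suc (countF-not (p ∘ suc))
... | false = trans (+-suc _ _) (cong suc (countF-not (p ∘ suc)))

T⇒≡ : ∀ {b} → T b → b ≡ true
T⇒≡ = Equivalence.to T-≡

≡⇒T : ∀ {b} → b ≡ true → T b
≡⇒T = Equivalence.from T-≡

iter-+ : ∀ {A : Set} (f : A → A) j k x → iter f (j + k) x ≡ iter f j (iter f k x)
iter-+ f zero    k x = refl
iter-+ f (suc j) k x = cong f (iter-+ f j k x)

iter-* : ∀ {A : Set} {f : A → A} {x p} → iter f p x ≡ x → ∀ q → iter f (q * p) x ≡ x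
iter-* eq zero = refl
iter-* {f = f} {x} {p} eq (suc q) =
  trans (iter-+ f p (q * p) x) (trans (cong (iter f p) (iter-* eq q)) eq)

iter-% : ∀ {A : Set} {f : A → A} {x p} → iter f (suc p) x ≡ x → ∀ k → iter f (k % suc p) x ≡ iter f k x
iter-% {f = f} {x} {p} eq k = begin
  iter f (k % suc p) x                              ≡⟨ cong (iter f (k % suc p)) (iter-* eq (k / suc p)) ⟨
  iter f (k % suc p) (iter f (k / suc p * suc p) x) ≡⟨ iter-+ f (k % suc p) _ x ⟨
  iter f (k % suc p + k / suc p * suc p) x          ≡⟨ cong (λ j → iter f j x) (m≡m%n+[m/n]*n k (suc p)) ⟨
  iter f k x                                        ∎
  where open ≡-Reasoning

-- The rotation at a cubic vertex

module Rotation {n} (G : SimpleGraph n) (R : RotationSystem G) (cubic : Cubic G) where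

  infix 4 _—_
  _—_ : Fin n → Fin n → Set
  u — v = adj G u v ≡ true

  r : Fin n → Fin n → Fin n
  r = rot R

  f : Dart n → Dart n
  f = facePerm R

  IsDart : Dart n → Set
  IsDart (u , v) = u — v

  —-sym : ∀ {u v} → u — v → v — u
  —-sym {u} {v} e = trans (symmetric G v u) e

  —-≢ : ∀ {u v} → u — v → u ≢ v
  —-≢ {u} e refl with trans (sym e) (irrefl G u)
  ... | ()

  r— : ∀ {v u} → v — u → v — r v u
  r— {v} {u} e = T⇒≡ (rot-nbr R v u (≡⇒T e))

  r-inj : ∀ {v u w} → v — u → v — w → r v u ≡ r v w → u ≡ w
  r-inj {v} {u} {w} e e′ = rot-inj R v u w (≡⇒T e) (≡⇒T e′)

  private
    not-degree : ∀ {k} v → degree G v ≡ k → k ≢ 3 → ⊥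
    not-degree v eq k≢3 = k≢3 (trans (sym eq) (cubic v))

  -- By cyclicity every neighbour is an iterate of `u`, so a fixed point would be the only neighbour
  -- and `v` would have degree 1.
  r≢ : ∀ {v u} → v — u → r v u ≢ u
  r≢ {v} {u} e fix = not-degree v (countF-exact ([] ∷ []) cover (e ∷ [])) (λ ())
    where
    stay : ∀ k → iter (r v) k u ≡ u
    stay zero    = refl
    stay (suc k) = trans (cong (r v) (stay k)) fix
    cover : ∀ w → v — w → w ∈ u ∷ []
    cover w e′ with rot-cyclic R v u w (≡⇒T e) (≡⇒T e′)
    ... | k , eq = here (trans (sym eq) (stay k))

  r²≢ : ∀ {v u} → v — u → r v (r v u) ≢ u
  r²≢ {v} {u} e fix =
    not-degree v (countF-exact ((≢-sym (r≢ e) ∷ []) ∷ [] ∷ []) cover (e ∷ r— e ∷ [])) (λ ())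
    where
    stay : ∀ k → iter (r v) k u ∈ u ∷ r v u ∷ []
    stay zero = here refl
    stay (suc k) with stay k
    ... | here eq         = there (here (cong (r v) eq))
    ... | there (here eq) = here (trans (cong (r v) eq) fix)
    cover : ∀ w → v — w → w ∈ u ∷ r v u ∷ []
    cover w e′ with rot-cyclic R v u w (≡⇒T e) (≡⇒T e′)
    ... | k , eq = subst (_∈ u ∷ r v u ∷ []) eq (stay k)

  -- Otherwise the first four iterates would be pairwise distinct neighbours, one too many for a
  -- cubic vertex.
  r³≡ : ∀ {v u} → v — u → r v (r v (r v u)) ≡ u
  r³≡ {v} {u} e with r v (r v (r v u)) ≟ u
  ... | yes eq = eq
  ... | no neq = ⊥-elim (<-irrefl refl
          (subst (4 ≤_) (cubic v) (countF-unique four (e ∷ e₁ ∷ e₂ ∷ r— e₂ ∷ []))))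
    where
    e₁ = r— e
    e₂ = r— e₁
    four : Unique (u ∷ r v u ∷ r v (r v u) ∷ r v (r v (r v u)) ∷ [])
    four = (≢-sym (r≢ e) ∷ ≢-sym (r²≢ e) ∷ ≢-sym neq ∷ [])
         ∷ (≢-sym (r≢ e₁) ∷ ≢-sym (r²≢ e₁) ∷ [])
         ∷ (≢-sym (r≢ e₂) ∷ []) ∷ [] ∷ []

  around : Fin n → Fin n → List (Fin n)
  around v u = u ∷ r v u ∷ r v (r v u) ∷ []

  around-unique : ∀ {v u} → v — u → Unique (around v u)
  around-unique e = (≢-sym (r≢ e) ∷ ≢-sym (r²≢ e) ∷ []) ∷ (≢-sym (r≢ (r— e)) ∷ []) ∷ [] ∷ []

  around-cover : ∀ {v u w} → v — u → v — w → w ∈ around v u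
  around-cover {v} {u} {w} e e′ with rot-cyclic R v u w (≡⇒T e) (≡⇒T e′)
  ... | k , eq = subst (_∈ around v u) eq (stay k)
    where
    stay : ∀ k → iter (r v) k u ∈ around v u
    stay zero = here refl
    stay (suc k) with stay k
    ... | here eq                 = there (here (cong (r v) eq))
    ... | there (here eq)         = there (there (here (cong (r v) eq)))
    ... | there (there (here eq)) = here (trans (cong (r v) eq) (r³≡ e))

  neighbour : ∀ v → ∃ λ u → v — u
  neighbour v with any? (λ u → adj G v u ≟ᵇ true)
  ... | yes u  = u
  ... | no ¬u = ⊥-elim (not-degree v (countF-exact [] (λ i e → contradiction (i , e) ¬u) []) (λ ()))

  f-dart : ∀ {d} → IsDart d → IsDart (f d)
  f-dart e = r— (—-sym e)

  iter-dart : ∀ k {d} → IsDart d → IsDart (iter f k d)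
  iter-dart zero    e = e
  iter-dart (suc k) e = f-dart (iter-dart k e)

  f-inj : ∀ {d d′} → IsDart d → IsDart d′ → f d ≡ f d′ → d ≡ d′
  f-inj {u , v} {u′ , v′} e e′ eq with cong proj₁ eq
  ... | refl = cong (_, v) (r-inj (—-sym e) (—-sym e′) (cong proj₂ eq))

  iter-inj : ∀ k {d d′} → IsDart d → IsDart d′ → iter f k d ≡ iter f k d′ → d ≡ d′
  iter-inj zero    e e′ eq = eq
  iter-inj (suc k) e e′ eq = iter-inj k e e′ (f-inj (iter-dart k e) (iter-dart k e′) eq)

  iter-return : ∀ {i j d} → IsDart d → i < j → iter f i d ≡ iter f j d → iter f (j ∸ i) d ≡ d
  iter-return {i} {j} {d} e i<j eq = iter-inj i (iter-dart (j ∸ i) e) e (begin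
    iter f i (iter f (j ∸ i) d) ≡⟨ iter-+ f i (j ∸ i) d ⟨
    iter f (i + (j ∸ i)) d      ≡⟨ cong (λ k → iter f k d) (trans (+-comm i _) (m∸n+n≡m (<⇒≤ i<j))) ⟩
    iter f j d                  ≡⟨ eq ⟨
    iter f i d                  ∎)
    where open ≡-Reasoning

  -- The bound matters: `leastInOrbit` inspects only `n * n` iterates, and these must exhaust the
  -- orbit. Pigeonhole on `n * n + 1` iterates gives a repetition, which `iter-return` moves back to
  -- `d` because `f` is injective on darts.
  period : ∀ {d} → IsDart d → ∃ λ p → p < n * n × iter f (suc p) d ≡ d
  period {d} e with pigeonhole (n<1+n (n * n)) code
    where
    code : Fin (suc (n * n)) → Fin (n * n)
    code k = combine (proj₁ (iter f (toℕ k) d)) (proj₂ (iter f (toℕ k) d))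
  ... | i , j , i<j , eq with combine-injective _ _ _ _ eq
  ...   | eq₁ , eq₂ with toℕ j ∸ toℕ i in gap | m<n⇒0<n∸m i<j
                       | iter-return {toℕ i} {toℕ j} e i<j (cong₂ _,_ eq₁ eq₂)
  ...     | suc p | _ | back = p , p<n² , back
    where
    p<n² : p < n * n
    p<n² = ≤-trans (≤-trans (≤-reflexive (sym gap)) (m∸n≤m (toℕ j) (toℕ i))) (s≤s⁻¹ (toℕ<n j))

-- Finite enumeration and minimisation

pairsWhere : ∀ {n} (p : Fin n → Fin n → Bool) → List (Fin n × Fin n)
pairsWhere {n} p = filter (T? ∘ uncurry p) (cartesianProduct (allFin n) (allFin n))

pairsWhere-unique : ∀ {n} (p : Fin n → Fin n → Bool) → Unique (pairsWhere p)
pairsWhere-unique {n} p = filter⁺ (T? ∘ uncurry p) (cartesianProduct⁺ (allFin⁺ n) (allFin⁺ n))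

∈-pairsWhere⁺ : ∀ {n} (p : Fin n → Fin n → Bool) → ∀ {u v} → p u v ≡ true → (u , v) ∈ pairsWhere p
∈-pairsWhere⁺ p {u} {v} puv =
  ∈-filter⁺ (T? ∘ uncurry p) (∈-cartesianProduct⁺ (∈-allFin u) (∈-allFin v)) (≡⇒T puv)

∈-pairsWhere⁻ : ∀ {n} (p : Fin n → Fin n → Bool) → ∀ {u v} → (u , v) ∈ pairsWhere p → p u v ≡ true
∈-pairsWhere⁻ {n} p e =
  T⇒≡ (proj₂ (∈-filter⁻ (T? ∘ uncurry p) {xs = cartesianProduct (allFin n) (allFin n)} e))

length-pairsWhere : ∀ {n} (p : Fin n → Fin n → Bool) →
                    length (pairsWhere p) ≡ sumF (λ u → countF (p u))
length-pairsWhere {n} p = rows id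
  where
  P? = T? ∘ uncurry p
  row : ∀ {k} u (g : Fin k → Fin n) →
        length (filter P? (map (u ,_) (tabulate g))) ≡ countF (p u ∘ g)
  row {zero}  u g = refl
  row {suc k} u g with p u (g zero)
  ... | true  = cong suc (row u (g ∘ suc))
  ... | false = row u (g ∘ suc)
  rows : ∀ {k} (g : Fin k → Fin n) →
         length (filter P? (cartesianProduct (tabulate g) (allFin n))) ≡ sumF (λ i → countF (p (g i)))
  rows {zero}  g = refl
  rows {suc k} g = begin
    length (filter P? (map (g zero ,_) (allFin n) ++ rest))
      ≡⟨ cong length (filter-++ P? (map (g zero ,_) (allFin n)) rest) ⟩
    length (filter P? (map (g zero ,_) (allFin n)) ++ filter P? rest)
      ≡⟨ length-++ (filter P? (map (g zero ,_) (allFin n))) ⟩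
    length (filter P? (map (g zero ,_) (allFin n))) + length (filter P? rest)
      ≡⟨ cong₂ _+_ (row (g zero) id) (rows (g ∘ suc)) ⟩
    countF (p (g zero)) + sumF (λ i → countF (p (g (suc i)))) ∎
    where
    open ≡-Reasoning
    rest = cartesianProduct (tabulate (g ∘ suc)) (allFin n)

lookup-injective : ∀ {A : Set} {xs : List A} → Unique xs → ∀ {i j} →
                   lookup xs i ≡ lookup xs j → i ≡ j
lookup-injective {xs = x ∷ xs} (x∉ ∷ uniq) {zero}  {zero}  eq = refl
lookup-injective {xs = x ∷ xs} (x∉ ∷ uniq) {zero}  {suc j} eq =
  contradiction eq (All.lookup x∉ (∈-lookup j))
lookup-injective {xs = x ∷ xs} (x∉ ∷ uniq) {suc i} {zero}  eq =
  contradiction (sym eq) (All.lookup x∉ (∈-lookup i))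
lookup-injective {xs = x ∷ xs} (x∉ ∷ uniq) {suc i} {suc j} eq = cong suc (lookup-injective uniq eq)

argmin : (g : ℕ → ℕ) → ∀ N → ∃ λ k → k ≤ N × (∀ {j} → j ≤ N → g k ≤ g j)
argmin g zero = 0 , z≤n , λ { z≤n → ≤-refl }
argmin g (suc N) with argmin g N
... | k , k≤N , min with ≤-total (g k) (g (suc N))
...   | inj₁ le = k , m≤n⇒m≤1+n k≤N , below
  where
  below : ∀ {j} → j ≤ suc N → g k ≤ g j
  below j≤ with m≤n⇒m<n∨m≡n j≤
  ... | inj₁ j<   = min (s≤s⁻¹ j<)
  ... | inj₂ refl = le
...   | inj₂ ge = suc N , ≤-refl , below
  where
  below : ∀ {j} → j ≤ suc N → g (suc N) ≤ g j
  below j≤ with m≤n⇒m<n∨m≡n j≤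
  ... | inj₁ j<   = ≤-trans ge (min (s≤s⁻¹ j<))
  ... | inj₂ refl = ≤-refl

allF⁺ : ∀ {k} {p : Fin k → Bool} → (∀ i → p i ≡ true) → allF p ≡ true
allF⁺ {zero}  all = refl
allF⁺ {suc k} all = cong₂ _∧_ (all zero) (allF⁺ (all ∘ suc))

allF⁻ : ∀ {k} {p : Fin k → Bool} → allF p ≡ true → ∀ i → p i ≡ true
allF⁻ {suc k} all zero    = ∧-conicalˡ _ _ all
allF⁻ {suc k} {p} all (suc i) = allF⁻ (∧-conicalʳ (p zero) _ all) i

dartCode-injective : ∀ {n} {d d′ : Dart n} → dartCode d ≡ dartCode d′ → d ≡ d′
dartCode-injective {n} {u , v} {u′ , v′} eq =
  uncurry (cong₂ _,_) (combine-injective u v u′ v′ (toℕ-injective (begin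
    toℕ (combine u v)      ≡⟨ code u v ⟩
    dartCode (u , v)       ≡⟨ eq ⟩
    dartCode (u′ , v′)     ≡⟨ code u′ v′ ⟨
    toℕ (combine u′ v′)    ∎)))
  where
  open ≡-Reasoning
  code : ∀ (a b : Fin n) → toℕ (combine a b) ≡ toℕ a * n + toℕ b
  code a b = trans (toℕ-combine a b) (cong (_+ toℕ b) (*-comm n (toℕ a)))

-- Faces as orbits of darts

-- The interface through which faces are used: `face u v` is the orbit of the dart from `u` to `v`,
-- read as the face on its left, and is arbitrary where `u` and `v` are not adjacent.
record Faces {n} (G : SimpleGraph n) (R : RotationSystem G) : Set where
  field
    m     : ℕ
    face  : Fin n → Fin n → Fin m
    face-next : ∀ {u v} → adj G u v ≡ true → face v (rot R v u) ≡ face u v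
    orbit : ∀ {u v u′ v′} → adj G u v ≡ true → adj G u′ v′ ≡ true → face u v ≡ face u′ v′ →
            ∃ λ k → iter (facePerm R) k (u , v) ≡ (u′ , v′)
    dart  : ∀ i → ∃₂ λ u v → adj G u v ≡ true × face u v ≡ i
    m≡numFaces : m ≡ numFaces R

module _ {n} (G : SimpleGraph n) (R : RotationSystem G) (cubic : Cubic G) (origin : Fin n) where
  open Rotation G R cubic

  private
    infix 4 _⇝_
    _⇝_ : Dart n → Dart n → Set
    d ⇝ d′ = ∃ λ k → iter f k d ≡ d′

    ⇝-trans : ∀ {d e g} → d ⇝ e → e ⇝ g → d ⇝ g
    ⇝-trans {d} (k , refl) (l , refl) = l + k , iter-+ f l k d

    ⇝-sym : ∀ {d e} → IsDart d → d ⇝ e → e ⇝ d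
    ⇝-sym {d} isd (k , refl) with period isd
    -- `k * suc p` is a multiple of the period that is at least `k`, so the truncated subtraction is
    -- exact.
    ... | p , _ , back = k * suc p ∸ k , (begin
      iter f (k * suc p ∸ k) (iter f k d) ≡⟨ iter-+ f (k * suc p ∸ k) k d ⟨
      iter f (k * suc p ∸ k + k) d        ≡⟨ cong (λ j → iter f j d) (m∸n+n≡m (m≤m*n k (suc p))) ⟩
      iter f (k * suc p) d                ≡⟨ iter-* back k ⟩
      d                                   ∎)
      where open ≡-Reasoning

    ⇝-short : ∀ {d e} → IsDart d → d ⇝ e → ∃ λ (k : Fin (n * n)) → iter f (toℕ k) d ≡ e
    ⇝-short {d} isd (k , refl) with period isd
    ... | p , p< , back = fromℕ< k%< , (begin
      iter f (toℕ (fromℕ< k%<)) d               ≡⟨ cong (λ j → iter f j d) (toℕ-fromℕ< k%<) ⟩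
      iter f (k % suc p) d                      ≡⟨ iter-% back k ⟩
      iter f k d                                ∎)
      where
      open ≡-Reasoning
      k%< : k % suc p < n * n
      k%< = ≤-trans (m%n<n k (suc p)) p<

    ⇝-dart : ∀ {d e} → IsDart d → d ⇝ e → IsDart e
    ⇝-dart isd (k , refl) = iter-dart k isd

    Least : Dart n → Set
    Least d = leastInOrbit R d ≡ true

    least-≤ : ∀ {d e} → IsDart d → Least d → d ⇝ e → dartCode d ≤ dartCode e
    least-≤ isd least d⇝e with ⇝-short isd d⇝e
    ... | k , refl = ≤ᵇ⇒≤ _ _ (≡⇒T (allF⁻ least k))

    least-unique : ∀ {d e} → IsDart d → Least d → Least e → d ⇝ e → d ≡ e
    least-unique isd ld le d⇝e = dartCode-injective
      (≤-antisym (least-≤ isd ld d⇝e) (least-≤ (⇝-dart isd d⇝e) le (⇝-sym isd d⇝e)))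

    least : ∀ {d} → IsDart d → ∃ λ e → d ⇝ e × Least e
    least {d} isd with argmin (λ k → dartCode (iter f k d)) (n * n)
    ... | k , _ , min = iter f k d , (k , refl) , allF⁺ {n * n} below
      where
      below : ∀ i → (dartCode (iter f k d) ≤ᵇ dartCode (iter f (toℕ i) (iter f k d))) ≡ true
      below i with ⇝-short isd (⇝-trans (k , refl) (toℕ i , refl))
      ... | j , eq = T⇒≡ (≤⇒≤ᵇ (subst (λ e → _ ≤ dartCode e) eq (min {toℕ j} (<⇒≤ (toℕ<n j)))))

    isRep : Fin n → Fin n → Bool
    isRep u v = adj G u v ∧ leastInOrbit R (u , v)

    reps : List (Dart n)
    reps = pairsWhere isRep

    rep : Fin (length reps) → Dart n
    rep = lookup reps

    rep-dart : ∀ i → IsDart (rep i)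
    rep-dart i = ∧-conicalˡ _ _ (∈-pairsWhere⁻ isRep (∈-lookup i))

    rep-least : ∀ i → Least (rep i)
    rep-least i = ∧-conicalʳ (uncurry (adj G) (rep i)) _ (∈-pairsWhere⁻ isRep (∈-lookup i))

    find : ∀ {d} → IsDart d → ∃ λ i → d ⇝ rep i
    find isd with least isd
    ... | e , d⇝e , le = index e∈ , subst (_ ⇝_) (Any.lookup-index e∈) d⇝e
      where
      e∈ : e ∈ reps
      e∈ = ∈-pairsWhere⁺ isRep (cong₂ _∧_ (⇝-dart isd d⇝e) le)

    -- The label of pairs that are not darts; an edge at `origin` guarantees that there is a label
    -- at all.
    someFace : Fin (length reps)
    someFace = proj₁ (find {origin , proj₁ (neighbour origin)} (proj₂ (neighbour origin)))

    search : ∀ d → Dec (∃ λ i → ∃ λ (k : Fin (n * n)) → iter f (toℕ k) d ≡ rep i)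
    search d = any? λ i → any? λ k → ≡-dec _≟_ _≟_ (iter f (toℕ k) d) (rep i)

    label : Dart n → Fin (length reps)
    label d with search d
    ... | yes (i , _) = i
    ... | no _        = someFace

    label-⇝ : ∀ {d} → IsDart d → d ⇝ rep (label d)
    label-⇝ {d} isd with search d
    ... | yes (i , k , eq) = toℕ k , eq
    ... | no none with find isd
    ...   | i , d⇝ = contradiction (i , ⇝-short isd d⇝) none

    label-unique : ∀ {d i} → IsDart d → d ⇝ rep i → label d ≡ i
    label-unique {d} {i} isd d⇝ = lookup-injective (pairsWhere-unique isRep)
      (least-unique (rep-dart _) (rep-least _) (rep-least i)
        (⇝-trans (⇝-sym isd (label-⇝ isd)) d⇝))

  faces : Faces G R
  faces = record
    { m = length reps
    ; face = λ u v → label (u , v)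
    ; face-next = λ {u} {v} e → label-unique (f-dart e)
        (⇝-trans (⇝-sym e (1 , refl)) (label-⇝ e))
    ; orbit = λ {u} {v} e e′ eq →
        ⇝-trans (label-⇝ e) (subst (_⇝ _) (sym (cong rep eq)) (⇝-sym e′ (label-⇝ e′)))
    ; dart = λ i → proj₁ (rep i) , proj₂ (rep i) , rep-dart i , label-unique (rep-dart i) (0 , refl)
    ; m≡numFaces = length-pairsWhere isRep
    }

-- Sums modulo 2 over lists

≢true⇒≡false : ∀ {b} → b ≢ true → b ≡ false
≢true⇒≡false {true}  b≢ = contradiction refl b≢
≢true⇒≡false {false} b≢ = refl

xor-false⇒≡ : ∀ {a b} → a xor b ≡ false → a ≡ b
xor-false⇒≡ {false} {false} eq = refl
xor-false⇒≡ {true}  {true}  eq = refl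

xor-interchange : ∀ a b c d → (a xor b) xor (c xor d) ≡ (a xor c) xor (b xor d)
xor-interchange = ⊕.interchange

module _ {E : Set} where

  ⨁ : (E → Bool) → List E → Bool
  ⨁ g []       = false
  ⨁ g (e ∷ es) = g e xor ⨁ g es

  ⨁-cong : ∀ {g h} es → (∀ {e} → e ∈ es → g e ≡ h e) → ⨁ g es ≡ ⨁ h es
  ⨁-cong []       eq = refl
  ⨁-cong (e ∷ es) eq = cong₂ _xor_ (eq (here refl)) (⨁-cong es (eq ∘ there))

  ⨁-false : ∀ {g} es → (∀ {e} → e ∈ es → g e ≡ false) → ⨁ g es ≡ false
  ⨁-false []       eq = refl
  ⨁-false (e ∷ es) eq = cong₂ _xor_ (eq (here refl)) (⨁-false es (eq ∘ there))

  ⨁-xor : ∀ g h es → ⨁ (λ e → g e xor h e) es ≡ ⨁ g es xor ⨁ h es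
  ⨁-xor g h []       = refl
  ⨁-xor g h (e ∷ es) = trans (cong ((g e xor h e) xor_) (⨁-xor g h es)) (xor-interchange (g e) _ _ _)

  ⨁-++ : ∀ g es es′ → ⨁ g (es ++ es′) ≡ ⨁ g es xor ⨁ g es′
  ⨁-++ g []       es′ = refl
  ⨁-++ g (e ∷ es) es′ = trans (cong (g e xor_) (⨁-++ g es es′)) (sym (xor-assoc (g e) _ _))

  ⨁-single : ∀ {g es x} → Unique es → x ∈ es → (∀ {y} → y ∈ es → y ≢ x → g y ≡ false) →
             ⨁ g es ≡ g x
  ⨁-single {g} {e ∷ es} (e∉ ∷ uniq) (here refl) off = trans
    (cong (g e xor_) (⨁-false es (λ y∈ → off (there y∈) (≢-sym (All.lookup e∉ y∈)))))
    (xor-identityʳ (g e))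
  ⨁-single {g} {e ∷ es} {x} (e∉ ∷ uniq) (there x∈) off = cong₂ _xor_
    (off (here refl) (All.lookup e∉ x∈)) (⨁-single uniq x∈ (off ∘ there))

⨁-pairsWhere : ∀ {n} (p : Fin n → Fin n → Bool) g →
               ⨁ g (pairsWhere p) ≡ ⊕.∑ (λ u → ⊕.∑ (λ v → p u v ∧ g (u , v)))
⨁-pairsWhere {n} p g = rows id
  where
  P? = T? ∘ uncurry p
  row : ∀ {k} u (h : Fin k → Fin n) →
        ⨁ g (filter P? (map (u ,_) (tabulate h))) ≡ ⊕.∑ (λ i → p u (h i) ∧ g (u , h i))
  row {zero}  u h = refl
  row {suc k} u h with p u (h zero)
  ... | true  = cong (g (u , h zero) xor_) (row u (h ∘ suc))
  ... | false = row u (h ∘ suc)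
  rows : ∀ {k} (h : Fin k → Fin n) →
         ⨁ g (filter P? (cartesianProduct (tabulate h) (allFin n))) ≡
         ⊕.∑ (λ i → ⊕.∑ (λ v → p (h i) v ∧ g (h i , v)))
  rows {zero}  h = refl
  rows {suc k} h = begin
    ⨁ g (filter P? (map (h zero ,_) (allFin n) ++ rest))
      ≡⟨ cong (⨁ g) (filter-++ P? (map (h zero ,_) (allFin n)) rest) ⟩
    ⨁ g (filter P? (map (h zero ,_) (allFin n)) ++ filter P? rest)
      ≡⟨ ⨁-++ g (filter P? (map (h zero ,_) (allFin n))) _ ⟩
    ⨁ g (filter P? (map (h zero ,_) (allFin n))) xor ⨁ g (filter P? rest)
      ≡⟨ cong₂ _xor_ (row (h zero) id) (rows (h ∘ suc)) ⟩
    _ ∎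
    where
    open ≡-Reasoning
    rest = cartesianProduct (tabulate (h ∘ suc)) (allFin n)

-- Spanning forests and cuts

-- A partition of `X` into exactly `c` classes: the section `s` keeps `ℓ` surjective, so that `c`
-- really counts components.
record Labelling (X : Set) (c : ℕ) : Set where
  field
    ℓ   : X → Fin c
    s   : Fin c → X
    ℓ∘s : ∀ i → ℓ (s i) ≡ i

identity : ∀ c → Labelling (Fin c) c
identity c = record { ℓ = id ; s = id ; ℓ∘s = λ _ → refl }

-- Merges the class `j` into the class `i` and renumbers the rest by closing the gap at `j`.
collapse : ∀ {c} {j i : Fin (suc c)} → j ≢ i → Fin (suc c) → Fin c
collapse {j = j} j≢i k with j ≟ k
... | yes _  = punchOut j≢i
... | no j≢k = punchOut j≢k

collapse-joins : ∀ {c} {j i : Fin (suc c)} (j≢i : j ≢ i) → collapse j≢i i ≡ collapse j≢i j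
collapse-joins {j = j} {i} j≢i with j ≟ i | j ≟ j
... | yes j≡i | _      = contradiction j≡i j≢i
... | no _    | yes _  = punchOut-cong j refl
... | no _    | no j≢j = contradiction refl j≢j

collapse-punchIn : ∀ {c} {j i : Fin (suc c)} (j≢i : j ≢ i) k → collapse j≢i (punchIn j k) ≡ k
collapse-punchIn {j = j} j≢i k with j ≟ punchIn j k
... | yes eq = contradiction (sym eq) (punchInᵢ≢i j k)
... | no neq = trans (punchOut-cong j refl) (punchOut-punchIn j)

-- Kruskal's algorithm: the edges of es are scanned one by one, and the
-- labelling records the components of the part scanned so far.  `forest` says
-- that tree edges carry no nonzero vector orthogonal to all coboundaries.
record Split {E X : Set} (l r : E → X) (es : List E) {c} (L : Labelling X c) : Set where
  open Labelling
  field
    {c′}    : ℕ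
    L′      : Labelling X c′
    tree    : List E
    cotree  : List E
    count   : length tree + c′ ≡ c
    lengths : length tree + length cotree ≡ length es
    joined  : ∀ {e} → e ∈ es → ℓ L′ (l e) ≡ ℓ L′ (r e)
    coarser : ∀ {x y} → ℓ L x ≡ ℓ L y → ℓ L′ x ≡ ℓ L′ y
    ⨁-split : ∀ g → ⨁ g es ≡ ⨁ g tree xor ⨁ g cotree
    covers  : ∀ {e} → e ∈ es → e ∈ tree ⊎ e ∈ cotree
    forest  : ∀ (κ : E → Bool) →
              (∀ (φ : X → Bool) → (∀ {x y} → ℓ L x ≡ ℓ L y → φ x ≡ φ y) →
                 ⨁ (λ e → κ e ∧ (φ (l e) xor φ (r e))) tree ≡ false) →
              ∀ {e} → e ∈ tree → κ e ≡ false

split : ∀ {E X : Set} (l r : E → X) (es : List E) {c} (L : Labelling X c) → Split l r es L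
split l r [] L = record
  { L′ = L ; tree = [] ; cotree = [] ; count = refl ; lengths = refl
  ; joined = λ () ; coarser = id ; ⨁-split = λ _ → refl ; covers = λ () ; forest = λ _ _ () }
split {E} {X} l r (e ∷ es) {c} L with Labelling.ℓ L (l e) ≟ Labelling.ℓ L (r e)
... | yes same = record
  { L′ = L′ ; tree = tree ; cotree = e ∷ cotree
  ; count = count
  ; lengths = trans (+-suc _ _) (cong suc lengths)
  ; joined = λ { (here refl) → coarser same ; (there e∈) → joined e∈ }
  ; coarser = coarser
  ; ⨁-split = λ g → trans (cong (g e xor_) (⨁-split g)) (swap (g e) (⨁ g tree) (⨁ g cotree))
  ; covers = λ { (here refl) → inj₂ (here refl)
               ; (there e∈) → [ inj₁ , inj₂ ∘ there ]′ (covers e∈) }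
  ; forest = forest }
  where
  open Split (split l r es L)
  swap : ∀ a b c → a xor (b xor c) ≡ b xor (a xor c)
  swap a b c = trans (sym (xor-assoc a b c)) (trans (cong (_xor c) (xor-comm a b)) (xor-assoc b a c))
... | no diff = merged c L diff
  where
  open Labelling
  merged : ∀ c (L : Labelling X c) → ℓ L (l e) ≢ ℓ L (r e) → Split l r (e ∷ es) L
  merged zero    L diff with ℓ L (l e)
  ... | ()
  merged (suc c) L diff = record
    { L′ = L′ ; tree = e ∷ tree ; cotree = cotree
    ; count = cong suc count
    ; lengths = cong suc lengths
    ; joined = λ { (here refl) → coarser join-e ; (there e∈) → joined e∈ }
    ; coarser = coarser ∘ cong (collapse (≢-sym diff))
    ; ⨁-split = λ g → trans (cong (g e xor_) (⨁-split g)) (sym (xor-assoc (g e) _ _))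
    ; covers = λ { (here refl) → inj₁ (here refl)
                 ; (there e∈) → [ inj₁ ∘ there , inj₂ ]′ (covers e∈) }
    ; forest = λ κ κ⊥ → λ { (here refl) → root κ κ⊥ ; (there e∈) → rest κ κ⊥ e∈ } }
    where
    L₁ : Labelling X c
    L₁ = record
      { ℓ = collapse (≢-sym diff) ∘ ℓ L
      ; s = s L ∘ punchIn (ℓ L (r e))
      ; ℓ∘s = λ i → trans (cong (collapse (≢-sym diff)) (ℓ∘s L _)) (collapse-punchIn (≢-sym diff) i) }
    open Split (split l r es L₁)
    join-e : ℓ L₁ (l e) ≡ ℓ L₁ (r e)
    join-e = collapse-joins (≢-sym diff)
    Orthogonal : (E → Bool) → Set
    Orthogonal κ = ∀ (φ : X → Bool) → (∀ {x y} → ℓ L x ≡ ℓ L y → φ x ≡ φ y) →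
                   ⨁ (λ e → κ e ∧ (φ (l e) xor φ (r e))) (e ∷ tree) ≡ false
    -- A `φ` that is constant on the classes of `L₁` takes equal values at the ends of `e`, so `e`
    -- contributes nothing and orthogonality passes to the remaining tree.
    rest : ∀ κ → Orthogonal κ → ∀ {e′} → e′ ∈ tree → κ e′ ≡ false
    rest κ κ⊥ = forest κ λ φ resp →
      trans (cong (_xor ⨁ (λ e → κ e ∧ (φ (l e) xor φ (r e))) tree) (sym (trans (cong (κ e ∧_) (δe φ resp)) (∧-zeroʳ (κ e)))))
            (κ⊥ φ (resp ∘ cong (collapse (≢-sym diff))))
      where
      δe : ∀ (φ : X → Bool) → (∀ {x y} → ℓ L₁ x ≡ ℓ L₁ y → φ x ≡ φ y) → φ (l e) xor φ (r e) ≡ false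
      δe φ resp = trans (cong (_xor φ (r e)) (resp join-e)) (xor-same (φ (r e)))
    root : ∀ κ → Orthogonal κ → κ e ≡ false
    root κ κ⊥ = begin
      κ e                                       ≡⟨ ∧-identityʳ (κ e) ⟨
      κ e ∧ true                                ≡⟨ cong (κ e ∧_) (cong₂ _xor_ φl φr) ⟨
      κ e ∧ (φ (l e) xor φ (r e))                ≡⟨ xor-identityʳ _ ⟨
      (κ e ∧ (φ (l e) xor φ (r e))) xor false    ≡⟨ cong ((κ e ∧ (φ (l e) xor φ (r e))) xor_) (⨁-false tree vanish) ⟨
      ⨁ (λ e → κ e ∧ (φ (l e) xor φ (r e))) (e ∷ tree) ≡⟨ κ⊥ φ (λ eq → cong (λ i → does (i ≟ ℓ L (l e))) eq) ⟩
      false                                     ∎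
      where
      open ≡-Reasoning
      -- Once `κ` vanishes on the later tree edges, the indicator of the component of `l e` isolates
      -- `κ e`, since `e` leaves that component.
      φ : X → Bool
      φ x = does (ℓ L x ≟ ℓ L (l e))
      φl : φ (l e) ≡ true
      φl = dec-true (ℓ L (l e) ≟ ℓ L (l e)) refl
      φr : φ (r e) ≡ false
      φr = dec-false (ℓ L (r e) ≟ ℓ L (l e)) (≢-sym diff)
      vanish : ∀ {e′} → e′ ∈ tree → κ e′ ∧ (φ (l e′) xor φ (r e′)) ≡ false
      vanish {e′} e∈ = cong (_∧ (φ (l e′) xor φ (r e′))) (rest κ κ⊥ e∈)

-- The cut lemma over the field with two elements

<ᵇ-xor : ∀ {a b} → a ≢ b → (a <ᵇ b) xor (b <ᵇ a) ≡ true
<ᵇ-xor {zero}  {zero}  a≢b = contradiction refl a≢b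
<ᵇ-xor {zero}  {suc b} a≢b = refl
<ᵇ-xor {suc a} {zero}  a≢b = refl
<ᵇ-xor {suc a} {suc b} a≢b = <ᵇ-xor (a≢b ∘ cong suc)

sameEdge : ∀ {n} → Dart n → Fin n → Fin n → Bool
sameEdge (a , b) u v = (does (u ≟ a) ∧ does (v ≟ b)) ∨ (does (u ≟ b) ∧ does (v ≟ a))

sameEdge-sym : ∀ {n} (k : Dart n) u v → sameEdge k u v ≡ sameEdge k v u
sameEdge-sym (a , b) u v = trans (∨-comm (does (u ≟ a) ∧ does (v ≟ b)) _)
  (cong₂ _∨_ (∧-comm (does (u ≟ b)) _) (∧-comm (does (u ≟ a)) _))

sameEdge⁻ : ∀ {n} {k : Dart n} {u v} → sameEdge k u v ≡ true → (u , v) ≡ k ⊎ (v , u) ≡ k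
sameEdge⁻ {k = a , b} {u} {v} eq with u ≟ a | v ≟ b | u ≟ b | v ≟ a
... | yes refl | yes refl | _        | _        = inj₁ refl
... | yes _    | no _     | yes refl | yes refl = inj₂ refl
... | no _     | yes _    | yes refl | yes refl = inj₂ refl
... | no _     | no _     | yes refl | yes refl = inj₂ refl

sameEdge-refl : ∀ {n} (a b : Fin n) → sameEdge (a , b) a b ≡ true
sameEdge-refl a b rewrite dec-true (a ≟ a) refl | dec-true (b ≟ b) refl = refl

-- Connectedness in the form in which it is applied, to bits `ψ`, to component labels and to
-- membership tests, without choosing paths.
Invariant⇒Constant : ∀ {n} → SimpleGraph n → Set₁
Invariant⇒Constant {n} G = ∀ {A : Set} (h : Fin n → A) →
  (∀ {u v} → adj G u v ≡ true → h u ≡ h v) → ∀ u v → h u ≡ h v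

module CutLemma {n} (G : SimpleGraph n) (R : RotationSystem G) (cubic : Cubic G) (origin : Fin n)
  (Φ : Faces G R) (euler : n + Faces.m Φ ≡ 2 + numEdges G) (connected : Invariant⇒Constant G) where

  open Rotation G R cubic
  open Faces Φ
  open Labelling

  isEdge : Fin n → Fin n → Bool
  isEdge u v = adj G u v ∧ (toℕ u <ᵇ toℕ v)

  edges : List (Dart n)
  edges = pairsWhere isEdge

  edge-or-reverse : ∀ {u v} → u — v → (u , v) ∈ edges ⊎ (v , u) ∈ edges
  edge-or-reverse {u} {v} e with <-cmp (toℕ u) (toℕ v)
  ... | tri< u<v _ _ = inj₁ (∈-pairsWhere⁺ isEdge (cong₂ _∧_ e (T⇒≡ (<⇒<ᵇ u<v))))
  ... | tri≈ _ u≡v _ = contradiction (toℕ-injective u≡v) (—-≢ e)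
  ... | tri> _ _ v<u = inj₂ (∈-pairsWhere⁺ isEdge (cong₂ _∧_ (—-sym e) (T⇒≡ (<⇒<ᵇ v<u))))

  edge⇒< : ∀ {u v} → (u , v) ∈ edges → toℕ u < toℕ v
  edge⇒< {u} {v} d∈ = <ᵇ⇒< (toℕ u) (toℕ v) (≡⇒T (∧-conicalʳ (adj G u v) _ (∈-pairsWhere⁻ isEdge d∈)))

  left right : Dart n → Fin m
  left  (u , v) = face u v
  right (u , v) = face v u

  -- The coboundary of a vertex set, that is, its edge cut. Its counterpart `∂` is the coboundary in
  -- the dual graph, that is, the boundary of a set of faces.
  δ : (Fin n → Bool) → Dart n → Bool
  δ ψ (u , v) = ψ u xor ψ v

  ∂ : (Fin m → Bool) → Dart n → Bool
  ∂ φ d = φ (left d) xor φ (right d)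

  -- Each of the three faces at `v` borders two of the three edges there, so its value occurs twice
  -- and cancels.
  ∂-around : ∀ φ {v u} → v — u → foldr _xor_ false (map (λ w → ∂ φ (v , w)) (around v u)) ≡ false
  ∂-around φ {v} {u} e = telescope
      (cong φ (face-next (—-sym e)))
      (cong φ (face-next (—-sym (r— e))))
      (cong φ (trans (cong (face v) (sym (r³≡ e))) (face-next (—-sym (r— (r— e))))))
    where
    telescope : ∀ {a b c a′ b′ c′} → b ≡ a′ → c ≡ b′ → a ≡ c′ →
                (a xor a′) xor ((b xor b′) xor ((c xor c′) xor false)) ≡ false
    telescope {a} {b} {c} refl refl refl = lemma a b c
      where
      lemma : ∀ a b c → (a xor b) xor ((b xor c) xor ((c xor a) xor false)) ≡ false
      lemma false false false = refl
      lemma false false true  = refl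
      lemma false true  false = refl
      lemma false true  true  = refl
      lemma true  false false = refl
      lemma true  false true  = refl
      lemma true  true  false = refl
      lemma true  true  true  = refl

  ∂-even : ∀ φ v → ⊕.∑ (λ u → adj G v u ∧ ∂ φ (v , u)) ≡ false
  ∂-even φ v = begin
    ⊕.∑ (λ u → adj G v u ∧ ∂ φ (v , u))
      ≡⟨ ⊕.∑-support (around-unique e) off ⟩
    foldr _xor_ false (map (λ u → adj G v u ∧ ∂ φ (v , u)) (around v u₀))
      ≡⟨ cong₂ _xor_ (on e) (cong₂ _xor_ (on (r— e)) (cong (_xor false) (on (r— (r— e))))) ⟩
    foldr _xor_ false (map (λ u → ∂ φ (v , u)) (around v u₀))
      ≡⟨ ∂-around φ e ⟩
    false ∎
    where
    open ≡-Reasoning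
    u₀ = proj₁ (neighbour v)
    e  = proj₂ (neighbour v)
    on : ∀ {u} → v — u → adj G v u ∧ ∂ φ (v , u) ≡ ∂ φ (v , u)
    on {u} e = cong (_∧ ∂ φ (v , u)) e
    off : ∀ u → u ∉ around v u₀ → adj G v u ∧ ∂ φ (v , u) ≡ false
    off u u∉ = cong (_∧ ∂ φ (v , u)) (≢true⇒≡false (u∉ ∘ around-cover e))

  -- Sorted by the endpoint whose `ψ` they carry, the terms at `u` add up to `ψ u` times the sum of
  -- `∂ φ` around `u`, which vanishes by `∂-even`. The exchange of summations brings each edge,
  -- listed once with increasing ends, to both of its ends.
  orthogonal : ∀ ψ φ → ⨁ (λ d → δ ψ d ∧ ∂ φ d) edges ≡ false
  orthogonal ψ φ = begin
    ⨁ (λ d → δ ψ d ∧ ∂ φ d) edges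
      ≡⟨ ⨁-pairsWhere isEdge (λ d → δ ψ d ∧ ∂ φ d) ⟩
    ⊕.∑ (λ u → ⊕.∑ (λ v → isEdge u v ∧ ((ψ u xor ψ v) ∧ ∂ φ (u , v))))
      ≡⟨ ⊕.∑-cong (λ u → trans (⊕.∑-cong (λ v → distrib (isEdge u v) (ψ u) (ψ v) (∂ φ (u , v))))
                               (⊕.∑-∙ (a u) (b u))) ⟩
    ⊕.∑ (λ u → ⊕.∑ (a u) xor ⊕.∑ (b u))
      ≡⟨ ⊕.∑-∙ (λ u → ⊕.∑ (a u)) (λ u → ⊕.∑ (b u)) ⟩
    ⊕.∑ (λ u → ⊕.∑ (a u)) xor ⊕.∑ (λ u → ⊕.∑ (b u))
      ≡⟨ cong (⊕.∑ (λ u → ⊕.∑ (a u)) xor_) (⊕.∑-swap b) ⟩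
    ⊕.∑ (λ u → ⊕.∑ (a u)) xor ⊕.∑ (λ u → ⊕.∑ (λ v → b v u))
      ≡⟨ ⊕.∑-∙ (λ u → ⊕.∑ (a u)) (λ u → ⊕.∑ (λ v → b v u)) ⟨
    ⊕.∑ (λ u → ⊕.∑ (a u) xor ⊕.∑ (λ v → b v u))
      ≡⟨ ⊕.∑-ε (λ u → trans (sym (⊕.∑-∙ (a u) (λ v → b v u))) (row u)) ⟩
    false ∎
    where
    open ≡-Reasoning
    a b : Fin n → Fin n → Bool
    a u v = isEdge u v ∧ (ψ u ∧ ∂ φ (u , v))
    b u v = isEdge u v ∧ (ψ v ∧ ∂ φ (u , v))
    distrib : ∀ w x y z → w ∧ ((x xor y) ∧ z) ≡ (w ∧ (x ∧ z)) xor (w ∧ (y ∧ z))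
    distrib false x     y     z = refl
    distrib true  false y     z = refl
    distrib true  true  false false = refl
    distrib true  true  false true  = refl
    distrib true  true  true  false = refl
    distrib true  true  true  true  = refl
    factor : ∀ s t x z → (s ∧ (x ∧ z)) xor (t ∧ (x ∧ z)) ≡ x ∧ ((s xor t) ∧ z)
    factor false false false z = refl
    factor false false true  z = refl
    factor false true  x     z = refl
    factor true  false x     z = xor-identityʳ (x ∧ z)
    factor true  true  x     z = trans (xor-same (x ∧ z)) (sym (∧-zeroʳ x))
    both : ∀ u v → isEdge u v xor isEdge v u ≡ adj G u v
    both u v rewrite symmetric G v u with adj G u v in e
    ... | true  = <ᵇ-xor (—-≢ e ∘ toℕ-injective)
    ... | false = refl
    term : ∀ u v → a u v xor b v u ≡ ψ u ∧ (adj G u v ∧ ∂ φ (u , v))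
    term u v = trans
      (cong (λ z → a u v xor (isEdge v u ∧ (ψ u ∧ z))) (xor-comm (φ (face v u)) (φ (face u v))))
      (trans (factor (isEdge u v) (isEdge v u) (ψ u) (∂ φ (u , v)))
             (cong (λ z → ψ u ∧ (z ∧ ∂ φ (u , v))) (both u v)))
    row : ∀ u → ⊕.∑ (λ v → a u v xor b v u) ≡ false
    row u = trans (⊕.∑-cong (term u)) zero-row
      where
      zero-row : ⊕.∑ (λ v → ψ u ∧ (adj G u v ∧ ∂ φ (u , v))) ≡ false
      zero-row with ψ u
      ... | false = ⊕.∑-ε {n} (λ _ → refl)
      ... | true  = ∂-even φ u

  -- The three faces at a vertex border each other, so `h` has one value per vertex; this value is
  -- the same at adjacent vertices, and connectedness of `G` does the rest.
  dual-connected : ∀ {A : Set} (h : Fin m → A) → (∀ {u v} → u — v → h (face u v) ≡ h (face v u)) →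
                   ∀ i j → h i ≡ h j
  dual-connected h inv i j with dart i | dart j
  ... | u , v , e , refl | u′ , v′ , e′ , refl =
    trans (at-vertex e) (trans (connected g g-inv u u′) (sym (at-vertex e′)))
    where
    g : Fin n → _
    g v = h (face v (proj₁ (neighbour v)))
    turn : ∀ {v u} → v — u → h (face v (r v u)) ≡ h (face v u)
    turn e = trans (cong h (face-next (—-sym e))) (inv (—-sym e))
    at-vertex : ∀ {v u} → v — u → h (face v u) ≡ g v
    at-vertex {v} e with neighbour v
    ... | u₀ , e₀ with around-cover e₀ e
    ...   | here refl                 = refl
    ...   | there (here refl)         = turn e₀
    ...   | there (there (here refl)) = trans (turn (r— e₀)) (turn e₀)
    g-inv : ∀ {u v} → u — v → g u ≡ g v
    g-inv e = trans (sym (at-vertex e)) (trans (inv e) (at-vertex (—-sym e)))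

  dual : Split left right edges (identity m)
  dual = split left right edges (identity m)

  open Split dual using (tree; cotree; L′; c′; covers; ⨁-split)

  one-component : c′ ≡ 1
  one-component = unique L′ constant
    where
    constant : ∀ i j → ℓ L′ i ≡ ℓ L′ j
    constant = dual-connected (ℓ L′) λ e → [ Split.joined dual , sym ∘ Split.joined dual ]′ (edge-or-reverse e)
    unique : ∀ {c} (L : Labelling (Fin m) c) → (∀ i j → ℓ L i ≡ ℓ L j) → c ≡ 1
    unique {zero} L _ with ℓ L (face origin origin)
    ... | ()
    unique {suc zero} L _ = refl
    unique {suc (suc c)} L const with trans (sym (ℓ∘s L zero)) (trans (const _ _) (ℓ∘s L (suc zero)))
    ... | ()

  -- By Euler's formula the edges outside a dual spanning tree are as many as
  -- those of a spanning tree of G.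
  length-cotree : suc (length cotree) ≡ n
  length-cotree = +-cancelʳ-≡ m (suc (length cotree)) n (begin
    suc (length cotree + m)                        ≡⟨ cong (λ k → suc (length cotree + k)) m≡ ⟨
    suc (length cotree + (length tree + 1))        ≡⟨ cong (λ k → suc (length cotree + k)) (+-comm (length tree) 1) ⟩
    suc (length cotree + suc (length tree))        ≡⟨ cong suc (+-suc _ _) ⟩
    2 + (length cotree + length tree)              ≡⟨ cong (2 +_) (+-comm (length cotree) _) ⟩
    2 + (length tree + length cotree)              ≡⟨ cong (2 +_) (Split.lengths dual) ⟩
    2 + length edges                               ≡⟨ cong (2 +_) (length-pairsWhere isEdge) ⟩
    2 + numEdges G                                 ≡⟨ euler ⟨
    n + m                                          ∎)
    where
    open ≡-Reasoning
    m≡ : length tree + 1 ≡ m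
    m≡ = trans (cong (length tree +_) (sym one-component)) (Split.count dual)

  -- A vector orthogonal to all boundaries is determined outside the dual spanning tree: once it is
  -- zero there, `forest` makes it zero on the tree as well.
  extend : ∀ (κ : Dart n → Bool) → (∀ φ → ⨁ (λ d → κ d ∧ ∂ φ d) edges ≡ false) →
           (∀ {d} → d ∈ cotree → κ d ≡ false) → ∀ {d} → d ∈ edges → κ d ≡ false
  extend κ κ⊥ off d∈ with covers d∈
  ... | inj₂ d∈cotree = off d∈cotree
  ... | inj₁ d∈tree = Split.forest dual κ (λ φ _ → begin
      ⨁ (λ d → κ d ∧ ∂ φ d) tree ≡⟨ xor-identityʳ _ ⟨
      ⨁ (λ d → κ d ∧ ∂ φ d) tree xor false
        ≡⟨ cong (⨁ (λ d → κ d ∧ ∂ φ d) tree xor_) (⨁-false cotree (λ {d} d∈ → cong (_∧ ∂ φ d) (off d∈))) ⟨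
      ⨁ (λ d → κ d ∧ ∂ φ d) tree xor ⨁ (λ d → κ d ∧ ∂ φ d) cotree
        ≡⟨ ⨁-split (λ d → κ d ∧ ∂ φ d) ⟨
      ⨁ (λ d → κ d ∧ ∂ φ d) edges ≡⟨ κ⊥ φ ⟩
      false ∎) d∈tree
    where open ≡-Reasoning

  constant : ∀ ψ → (∀ {d} → d ∈ cotree → δ ψ d ≡ false) → ∀ u v → ψ u ≡ ψ v
  constant ψ off = connected ψ λ e →
    [ xor-false⇒≡ ∘ zero-δ , sym ∘ xor-false⇒≡ ∘ zero-δ ]′ (edge-or-reverse e)
    where
    zero-δ : ∀ {d} → d ∈ edges → δ ψ d ≡ false
    zero-δ = extend (δ ψ) (orthogonal ψ) off

  -- Without `e` the cotree has `n - 2` edges, too few to connect `n` vertices, so it leaves at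
  -- least two components. The indicator of one of them changes across `e`, for otherwise its
  -- coboundary would vanish on the whole cotree and `constant` would apply.
  fundamental : ∀ pre {e post} → pre ++ e ∷ post ≡ cotree →
                ∃ λ ψ → (∀ {d} → d ∈ pre ++ post → δ ψ d ≡ false) × δ ψ e ≡ true
  fundamental pre {e} {post} eq = choose L″ c≥2 joined
    where
    open Split (split proj₁ proj₂ (pre ++ post) (identity n))
      renaming (L′ to L″; c′ to c″; tree to tree″; cotree to cotree″) using (count; lengths; joined)
    open ≡-Reasoning
    size : 2 + length (pre ++ post) ≡ n
    size = begin
      2 + length (pre ++ post)          ≡⟨ cong (2 +_) (length-++ pre) ⟩
      2 + (length pre + length post)    ≡⟨ cong suc (+-suc (length pre) (length post)) ⟨
      1 + (length pre + suc (length post)) ≡⟨ cong suc (length-++ pre) ⟨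
      1 + length (pre ++ e ∷ post)      ≡⟨ cong (suc ∘ length) eq ⟩
      1 + length cotree                 ≡⟨ length-cotree ⟩
      n                                 ∎
    c≥2 : ∃ λ c → c″ ≡ 2 + c
    c≥2 = length cotree″ , +-cancelˡ-≡ (length tree″) c″ (2 + length cotree″) (begin
      length tree″ + c″                    ≡⟨ count ⟩
      n                                    ≡⟨ size ⟨
      2 + length (pre ++ post)             ≡⟨ cong (2 +_) lengths ⟨
      2 + (length tree″ + length cotree″)  ≡⟨ cong suc (+-suc _ _) ⟨
      1 + (length tree″ + suc (length cotree″)) ≡⟨ +-suc _ _ ⟨
      length tree″ + (2 + length cotree″)  ∎)
    -- Abstracting over the number of classes allows the equation `c ≡ 2 + k` to be matched, which
    -- provides the two labels `zero` and `suc zero`.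
    choose : ∀ {c} (L : Labelling (Fin n) c) → (∃ λ k → c ≡ 2 + k) →
             (∀ {d} → d ∈ pre ++ post → ℓ L (proj₁ d) ≡ ℓ L (proj₂ d)) →
             ∃ λ ψ → (∀ {d} → d ∈ pre ++ post → δ ψ d ≡ false) × δ ψ e ≡ true
    choose L (k , refl) joined = ψ , zero-δ , one
      where
      ψ : Fin n → Bool
      ψ v = does (ℓ L v ≟ zero)
      zero-δ : ∀ {d} → d ∈ pre ++ post → δ ψ d ≡ false
      zero-δ {u , v} d∈ =
        trans (cong (λ i → does (i ≟ zero) xor ψ v) (joined d∈)) (xor-same (ψ v))
      one : δ ψ e ≡ true
      one with δ ψ e in eq′
      ... | true  = refl
      ... | false with trans (sym (cong (λ i → does (i ≟ zero)) (ℓ∘s L zero)))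
                         (trans (constant ψ off (s L zero) (s L (suc zero)))
                                (cong (λ i → does (i ≟ zero)) (ℓ∘s L (suc zero))))
        where
        off : ∀ {d} → d ∈ cotree → δ ψ d ≡ false
        off d∈ with ∈-++⁻ pre (subst (_ ∈_) (sym eq) d∈)
        ... | inj₁ d∈pre          = zero-δ (∈-++⁺ˡ d∈pre)
        ... | inj₂ (here refl)    = eq′
        ... | inj₂ (there d∈post) = zero-δ (∈-++⁺ʳ pre d∈post)
      ...   | ()

  -- Values on the cotree can be prescribed edge by edge, since the fundamental cut of `e` corrects
  -- the value at `e` and disturbs no other edge of the cotree. Demanding zero on `pre` is what lets
  -- the induction on `post` control the value at `e`.
  solve : ∀ (κ : Dart n → Bool) pre post → pre ++ post ≡ cotree →
          ∃ λ ψ → (∀ {d} → d ∈ pre → δ ψ d ≡ false) × (∀ {d} → d ∈ post → δ ψ d ≡ κ d)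
  solve κ pre []         eq = (λ _ → false) , (λ _ → refl) , λ ()
  solve κ pre (e ∷ post) eq
    with solve κ (pre ++ (e ∷ [])) post (trans (++-assoc pre (e ∷ []) post) eq) | κ e in κe
  ... | ψ , pre0 , postκ | false = ψ , pre0 ∘ ∈-++⁺ˡ ,
        λ { (here refl) → trans (pre0 (∈-++⁺ʳ pre (here refl))) (sym κe) ; (there d∈) → postκ d∈ }
  ... | ψ , pre0 , postκ | true with fundamental pre eq
  ...   | ψ′ , zero′ , one′ = (λ v → ψ v xor ψ′ v) , on-pre , on-post
    where
    δ-xor : ∀ d → δ (λ v → ψ v xor ψ′ v) d ≡ δ ψ d xor δ ψ′ d
    δ-xor (u , v) = xor-interchange (ψ u) (ψ′ u) (ψ v) (ψ′ v)
    on-pre : ∀ {d} → d ∈ pre → δ (λ v → ψ v xor ψ′ v) d ≡ false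
    on-pre {d} d∈ = trans (δ-xor d) (cong₂ _xor_ (pre0 (∈-++⁺ˡ d∈)) (zero′ (∈-++⁺ˡ d∈)))
    on-post : ∀ {d} → d ∈ e ∷ post → δ (λ v → ψ v xor ψ′ v) d ≡ κ d
    on-post (here refl) = trans (δ-xor e)
      (trans (cong₂ _xor_ (pre0 (∈-++⁺ʳ pre (here refl))) one′) (sym κe))
    on-post {d} (there d∈) = trans (δ-xor d)
      (trans (cong₂ _xor_ (postκ d∈) (zero′ (∈-++⁺ʳ pre d∈))) (xor-identityʳ (κ d)))

  -- `solve` matches `κ` on the cotree; the difference is orthogonal to all boundaries and zero on
  -- the cotree, hence zero by `extend`.
  coboundary : ∀ (κ : Dart n → Bool) → (∀ φ → ⨁ (λ d → κ d ∧ ∂ φ d) edges ≡ false) →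
               ∃ λ ψ → ∀ {d} → d ∈ edges → δ ψ d ≡ κ d
  coboundary κ κ⊥ with solve κ [] cotree refl
  ... | ψ , _ , agree = ψ , λ d∈ → xor-false⇒≡ (extend (λ d → δ ψ d xor κ d) orth off d∈)
    where
    open ≡-Reasoning
    off : ∀ {d} → d ∈ cotree → δ ψ d xor κ d ≡ false
    off {d} d∈ = trans (cong (_xor κ d) (agree d∈)) (xor-same (κ d))
    orth : ∀ φ → ⨁ (λ d → (δ ψ d xor κ d) ∧ ∂ φ d) edges ≡ false
    orth φ = begin
      ⨁ (λ d → (δ ψ d xor κ d) ∧ ∂ φ d) edges
        ≡⟨ ⨁-cong edges (λ {d} _ → ∧-distribʳ-xor (∂ φ d) (δ ψ d) (κ d)) ⟩
      ⨁ (λ d → (δ ψ d ∧ ∂ φ d) xor (κ d ∧ ∂ φ d)) edges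
        ≡⟨ ⨁-xor (λ d → δ ψ d ∧ ∂ φ d) (λ d → κ d ∧ ∂ φ d) edges ⟩
      ⨁ (λ d → δ ψ d ∧ ∂ φ d) edges xor ⨁ (λ d → κ d ∧ ∂ φ d) edges
        ≡⟨ cong₂ _xor_ (orthogonal ψ φ) (κ⊥ φ) ⟩
      false ∎

  -- `edges` lists only one orientation of each edge, while `∂ φ` does not depend on the
  -- orientation; hence the two cases.
  pair-edge : ∀ {a b} → a — b → ∀ φ → ⨁ (λ d → uncurry (sameEdge (a , b)) d ∧ ∂ φ d) edges ≡ ∂ φ (a , b)
  pair-edge {a} {b} e φ = [ direct , reversed ]′ (edge-or-reverse e)
    where
    g : Dart n → Bool
    g d = uncurry (sameEdge (a , b)) d ∧ ∂ φ d
    only : ∀ {x y} → (x , y) ≡ (a , b) ⊎ (y , x) ≡ (a , b) → (x , y) ∈ edges →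
           ∀ {d} → d ∈ edges → d ≢ (x , y) → g d ≡ false
    only {x} {y} xy x∈ {u , v} d∈ d≢ with sameEdge (a , b) u v in same
    ... | false = refl
    ... | true with sameEdge⁻ {k = a , b} {u} {v} same | xy
    ...   | inj₁ refl | inj₁ refl = contradiction refl d≢
    ...   | inj₁ refl | inj₂ refl = contradiction (edge⇒< d∈) (<-asym (edge⇒< x∈))
    ...   | inj₂ refl | inj₁ refl = contradiction (edge⇒< d∈) (<-asym (edge⇒< x∈))
    ...   | inj₂ refl | inj₂ refl = contradiction refl d≢
    direct : (a , b) ∈ edges → ⨁ g edges ≡ ∂ φ (a , b)
    direct d∈ = trans (⨁-single (pairsWhere-unique isEdge) d∈ (only (inj₁ refl) d∈))
                      (cong (_∧ ∂ φ (a , b)) (sameEdge-refl a b))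
    reversed : (b , a) ∈ edges → ⨁ g edges ≡ ∂ φ (a , b)
    reversed d∈ = trans (⨁-single (pairsWhere-unique isEdge) d∈ (only (inj₂ refl) d∈))
      (trans (cong (_∧ ∂ φ (b , a)) (trans (sameEdge-sym (a , b) b a) (sameEdge-refl a b)))
             (xor-comm (φ (face b a)) (φ (face a b))))

  crosses : List (Dart n) → Fin n → Fin n → Bool
  crosses ks u v = ⨁ (λ k → sameEdge k u v) ks

  crosses-sym : ∀ ks u v → crosses ks u v ≡ crosses ks v u
  crosses-sym ks u v = ⨁-cong ks (λ {k} _ → sameEdge-sym k u v)

  pair-edges : ∀ {ks} → All IsDart ks → ∀ φ →
               ⨁ (λ d → uncurry (crosses ks) d ∧ ∂ φ d) edges ≡ ⨁ (∂ φ) ks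
  pair-edges []       φ = ⨁-false edges (λ _ → refl)
  pair-edges {k ∷ ks} (e ∷ es) φ = begin
    ⨁ (λ d → (uncurry (sameEdge k) d xor uncurry (crosses ks) d) ∧ ∂ φ d) edges
      ≡⟨ ⨁-cong edges (λ {d} _ → ∧-distribʳ-xor (∂ φ d) (uncurry (sameEdge k) d) (uncurry (crosses ks) d)) ⟩
    ⨁ (λ d → (uncurry (sameEdge k) d ∧ ∂ φ d) xor (uncurry (crosses ks) d ∧ ∂ φ d)) edges
      ≡⟨ ⨁-xor (λ d → uncurry (sameEdge k) d ∧ ∂ φ d) (λ d → uncurry (crosses ks) d ∧ ∂ φ d) edges ⟩
    ⨁ (λ d → uncurry (sameEdge k) d ∧ ∂ φ d) edges xor ⨁ (λ d → uncurry (crosses ks) d ∧ ∂ φ d) edges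
      ≡⟨ cong₂ _xor_ (pair-edge e φ) (pair-edges es φ) ⟩
    ∂ φ k xor ⨁ (∂ φ) ks ∎
    where
    open ≡-Reasoning

  -- The hypothesis on ks says that, modulo 2, it is a closed walk in the dual graph.
  cut : ∀ {ks} → All IsDart ks → (∀ φ → ⨁ (∂ φ) ks ≡ false) →
        ∃ λ ψ → ∀ {u v} → u — v → ψ u xor ψ v ≡ crosses ks u v
  cut {ks} ks-darts closed
    with coboundary (uncurry (crosses ks)) (λ φ → trans (pair-edges ks-darts φ) (closed φ))
  ... | ψ , agree = ψ , λ {u} {v} e →
    [ agree , (λ d∈ → trans (xor-comm (ψ u) (ψ v)) (trans (agree d∈) (crosses-sym ks v u))) ]′
    (edge-or-reverse e)

-- Reachability and small finite facts

module _ {n} {P : Fin n → Bool} {E : Fin n → Fin n → Bool} where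

  reach-start : ∀ {u v} → ReachIn P E u v → T (P u)
  reach-start (here p)     = p
  reach-start (step p _ _) = p

  reach-trans : ∀ {u v w} → ReachIn P E u v → ReachIn P E v w → ReachIn P E u w
  reach-trans (here _)     q = q
  reach-trans (step p e s) q = step p e (reach-trans s q)

  reach-sym : (∀ u v → E u v ≡ E v u) → ∀ {u v} → ReachIn P E u v → ReachIn P E v u
  reach-sym E-sym (here p) = here p
  reach-sym E-sym (step {u} {w} p e s) = reach-trans (reach-sym E-sym s)
    (step (reach-start s) (subst T (E-sym u w) e) (here p))

  reach-invariant : ∀ {A : Set} (h : Fin n → A) →
                    (∀ {u v} → T (P u) → T (P v) → T (E u v) → h u ≡ h v) →
                    ∀ {u v} → ReachIn P E u v → h u ≡ h v
  reach-invariant h inv (here _)     = refl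
  reach-invariant h inv (step p e s) = trans (inv p (reach-start s) e) (reach-invariant h inv s)

avoid-≢ : ∀ {n} {x w : Fin n} → T (avoid x w) → w ≢ x
avoid-≢ {x = x} t refl with toℕ x ≡ᵇ toℕ x | ≡⇒≡ᵇ (toℕ x) (toℕ x) refl
avoid-≢ () refl | true | _

true-or-false : ∀ b → b ≡ true ⊎ b ≡ false
true-or-false true  = inj₁ refl
true-or-false false = inj₂ refl

third-colour : ∀ (x y : Fin 3) → ∃ λ z → z ≢ x × z ≢ y
third-colour zero             zero             = suc zero , (λ ()) , (λ ())
third-colour zero             (suc zero)       = suc (suc zero) , (λ ()) , (λ ())
third-colour zero             (suc (suc zero)) = suc zero , (λ ()) , (λ ())
third-colour (suc zero)       zero             = suc (suc zero) , (λ ()) , (λ ())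
third-colour (suc zero)       (suc zero)       = zero , (λ ()) , (λ ())
third-colour (suc zero)       (suc (suc zero)) = zero , (λ ()) , (λ ())
third-colour (suc (suc zero)) zero             = suc zero , (λ ()) , (λ ())
third-colour (suc (suc zero)) (suc zero)       = zero , (λ ()) , (λ ())
third-colour (suc (suc zero)) (suc (suc zero)) = zero , (λ ()) , (λ ())

least-witness : ∀ {P : ℕ → Set} → (∀ k → Dec (P k)) → ∀ {N} → P N →
                ∃ λ k → P k × (∀ {j} → j < k → ¬ P j)
least-witness {P} P? {N} pN = search N 0 (subst P (sym (+-identityʳ N)) pN) λ ()
  where
  search : ∀ fuel k → P (fuel + k) → (∀ {j} → j < k → ¬ P j) → ∃ λ k → P k × (∀ {j} → j < k → ¬ P j)
  search zero       k p below = k , p , below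
  search (suc fuel) k p below with P? k
  ... | yes pk = k , pk , below
  ... | no ¬pk = search fuel (suc k) (subst P (sym (+-suc fuel k)) p) λ {j} j<1+k →
        [ below , (λ { refl → ¬pk }) ]′ (m≤n⇒m<n∨m≡n (s≤s⁻¹ j<1+k))

-- Three-colouring non-crossing chords

module NonCrossing {R : ℕ → ℕ → Set} (R? : ∀ i j → Dec (R i j)) {K}
  (noncrossing : ∀ {i p j q} → i < p → p < j → j < q → q < K → R i j → ¬ R p q) where

  -- The alternative `p ≡ suc i` is the fallback when `i` has no chord into the interval. No index
  -- then lies strictly between `i` and `p`, so there is no chord from there that could pass over
  -- `p`.
  last-neighbour : ∀ {i j} → suc i < j → ∃ λ p → i < p × p < j ×
                   (∀ {y} → p < y → y < j → ¬ R i y) × (R i p ⊎ p ≡ suc i)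
  last-neighbour {i} {suc j} (s≤s i<j) = search j i<j ≤-refl λ j<y y<1+j _ → <⇒≱ j<y (s≤s⁻¹ y<1+j)
    where
    search : ∀ t → i < t → t < suc j → (∀ {y} → t < y → y < suc j → ¬ R i y) →
             ∃ λ p → i < p × p < suc j × (∀ {y} → p < y → y < suc j → ¬ R i y) × (R i p ⊎ p ≡ suc i)
    search (suc t) i<t t<j above with R? i (suc t)
    ... | yes rel = suc t , i<t , t<j , above , inj₁ rel
    ... | no ¬rel with m≤n⇒m<n∨m≡n (s≤s⁻¹ i<t)
    ...   | inj₂ refl = suc t , i<t , t<j , above , inj₂ refl
    ...   | inj₁ i<t′ = search t i<t′ (<-trans (n<1+n t) t<j) λ t<y y<j →
            [ (λ 1+t<y → above 1+t<y y<j) , (λ { refl → ¬rel }) ]′ (m≤n⇒m<n∨m≡n t<y)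

  Proper : ℕ → ℕ → (ℕ → Fin 3) → Set
  Proper i j col = ∀ {x y} → i ≤ x → x < y → y ≤ j → R x y → col x ≢ col y

  -- Colour the last neighbour p of i inside (i , j) with the third colour; no
  -- chord then leads from [i , p) to (p , j] except possibly i–j.
  colouring : ∀ fuel {i j} → i < j → j < K → j ≤ fuel + i → ∀ {cᵢ cⱼ} → cᵢ ≢ cⱼ →
              ∃ λ col → col i ≡ cᵢ × col j ≡ cⱼ × Proper i j col
  colouring zero i<j _ j≤i _ = contradiction j≤i (<⇒≱ i<j)
  colouring (suc fuel) {i} {j} i<j j<K j≤ {cᵢ} {cⱼ} ci≢cj with m≤n⇒m<n∨m≡n i<j
  ... | inj₂ refl = col , low ≤-refl , high (n<1+n i) , proper
    where
    col : ℕ → Fin 3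
    col x = if does (x ≤? i) then cᵢ else cⱼ
    low : ∀ {x} → x ≤ i → col x ≡ cᵢ
    low {x} x≤i = cong (if_then cᵢ else cⱼ) (dec-true (x ≤? i) x≤i)
    high : ∀ {x} → i < x → col x ≡ cⱼ
    high {x} i<x = cong (if_then cᵢ else cⱼ) (dec-false (x ≤? i) (<⇒≱ i<x))
    proper : Proper i (suc i) col
    proper i≤x x<y y≤1+i _ eq = ci≢cj
      (trans (sym (low (s≤s⁻¹ (≤-trans x<y y≤1+i)))) (trans eq (high (≤-<-trans i≤x x<y))))
  ... | inj₁ 1+i<j = glue
    where
    c = proj₁ (third-colour cᵢ cⱼ)
    c≢cᵢ = proj₁ (proj₂ (third-colour cᵢ cⱼ))
    c≢cⱼ = proj₂ (proj₂ (third-colour cᵢ cⱼ))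
    glue : ∃ λ col → col i ≡ cᵢ × col j ≡ cⱼ × Proper i j col
    glue with last-neighbour 1+i<j
    ... | p , i<p , p<j , last , near
      with colouring fuel i<p (<-trans p<j j<K) (s≤s⁻¹ (≤-trans p<j j≤)) (≢-sym c≢cᵢ)
         | colouring fuel p<j j<K (≤-trans j≤ (subst (_≤ fuel + p) (+-suc fuel i) (+-monoʳ-≤ fuel i<p))) c≢cⱼ
    ... | col₁ , at-i , at-p , proper₁ | col₂ , at-p′ , at-j , proper₂ = col , col-i , col-j , proper
      where
      col : ℕ → Fin 3
      col x = if does (x ≤? p) then col₁ x else col₂ x
      low : ∀ {x} → x ≤ p → col x ≡ col₁ x
      low {x} x≤p = cong (if_then col₁ x else col₂ x) (dec-true (x ≤? p) x≤p)
      high : ∀ {x} → p ≤ x → col x ≡ col₂ x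
      high {x} p≤x with m≤n⇒m<n∨m≡n p≤x
      ... | inj₁ p<x  = cong (if_then col₁ x else col₂ x) (dec-false (x ≤? p) (<⇒≱ p<x))
      ... | inj₂ refl = trans (low ≤-refl) (trans at-p (sym at-p′))
      col-i : col i ≡ cᵢ
      col-i = trans (low (<⇒≤ i<p)) at-i
      col-j : col j ≡ cⱼ
      col-j = trans (high (<⇒≤ p<j)) at-j
      proper : Proper i j col
      proper {x} {y} i≤x x<y y≤j rel eq with ≤-<-connex y p | ≤-<-connex p x
      ... | inj₁ y≤p | _ = proper₁ i≤x x<y y≤p rel
              (trans (sym (low (≤-trans (<⇒≤ x<y) y≤p))) (trans eq (low y≤p)))
      ... | inj₂ p<y | inj₁ p≤x = proper₂ p≤x x<y y≤j rel
              (trans (sym (high p≤x)) (trans eq (high (<⇒≤ p<y))))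
      ... | inj₂ p<y | inj₂ x<p with m≤n⇒m<n∨m≡n i≤x
      ...   | inj₁ i<x = [ (λ rel′ → noncrossing i<x x<p p<y (≤-<-trans y≤j j<K) rel′ rel)
                         , (λ { refl → <⇒≱ i<x (s≤s⁻¹ x<p) }) ]′ near
      ...   | inj₂ refl with m≤n⇒m<n∨m≡n y≤j
      ...     | inj₁ y<j  = last p<y y<j rel
      ...     | inj₂ refl = ci≢cj (trans (sym col-i) (trans eq col-j))

-- Counting edges, and connectedness from 2-connectivity

sumF-const : ∀ n k → sumF {n} (λ _ → k) ≡ n * k
sumF-const zero    k = refl
sumF-const (suc n) k = cong (k +_) (sumF-const n k)

countF-pair : ∀ {k} (q : Fin k → Bool) {i j} → i ≢ j →
              countF (λ x → q x ∧ (does (i ≟ x) xor does (j ≟ x))) ≡ indicator (q i) + indicator (q j)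
countF-pair q {i} {j} i≢j = begin
  countF (λ x → q x ∧ (does (i ≟ x) xor does (j ≟ x)))
    ≡⟨ sumF-∑ (indicator ∘ g) ⟩
  ℕΣ.∑ (indicator ∘ g)
    ≡⟨ ℕΣ.∑-support {xs = i ∷ j ∷ []} ((i≢j ∷ []) ∷ [] ∷ []) (λ x x∉ → cong indicator (off x x∉)) ⟩
  indicator (g i) + (indicator (g j) + 0)
    ≡⟨ cong₂ _+_ (cong indicator gi) (trans (+-identityʳ _) (cong indicator gj)) ⟩
  indicator (q i) + indicator (q j) ∎
  where
  open ≡-Reasoning
  g : Fin _ → Bool
  g x = q x ∧ (does (i ≟ x) xor does (j ≟ x))
  off : ∀ x → x ∉ i ∷ j ∷ [] → g x ≡ false
  off x x∉ = trans
    (cong (q x ∧_) (cong₂ _xor_ (dec-false (i ≟ x) (λ eq → x∉ (here (sym eq))))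
                                (dec-false (j ≟ x) (λ eq → x∉ (there (here (sym eq)))))))
    (∧-zeroʳ (q x))
  gi : g i ≡ q i
  gi = trans (cong (q i ∧_) (cong₂ _xor_ (dec-true (i ≟ i) refl) (dec-false (j ≟ i) (≢-sym i≢j))))
             (∧-identityʳ (q i))
  gj : g j ≡ q j
  gj = trans (cong (q j ∧_) (cong₂ _xor_ (dec-false (i ≟ j) i≢j) (dec-true (j ≟ j) refl)))
             (∧-identityʳ (q j))

countF-cong : ∀ {k} {p q : Fin k → Bool} → (∀ i → p i ≡ q i) → countF p ≡ countF q
countF-cong {p = p} {q} eq = trans (sumF-∑ (indicator ∘ p))
  (trans (ℕΣ.∑-cong (cong indicator ∘ eq)) (sym (sumF-∑ (indicator ∘ q))))

-- `numEdges` counts an edge at its smaller end; adding the transposed sum counts it at both ends,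
-- which yields the degrees.
handshake : ∀ {n} (G : SimpleGraph n) → Cubic G → numEdges G + numEdges G ≡ n * 3
handshake {n} G cubic = begin
  numEdges G + numEdges G
    ≡⟨ cong₂ _+_ double double ⟩
  ℕΣ.∑ (λ u → ℕΣ.∑ (e u)) + ℕΣ.∑ (λ u → ℕΣ.∑ (e u))
    ≡⟨ cong (ℕΣ.∑ (λ u → ℕΣ.∑ (e u)) +_) (ℕΣ.∑-swap e) ⟩
  ℕΣ.∑ (λ u → ℕΣ.∑ (e u)) + ℕΣ.∑ (λ u → ℕΣ.∑ (λ v → e v u))
    ≡⟨ ℕΣ.∑-∙ (λ u → ℕΣ.∑ (e u)) (λ u → ℕΣ.∑ (λ v → e v u)) ⟨
  ℕΣ.∑ (λ u → ℕΣ.∑ (e u) + ℕΣ.∑ (λ v → e v u))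
    ≡⟨ ℕΣ.∑-cong row ⟩
  ℕΣ.∑ {n} (λ _ → 3)
    ≡⟨ sumF-∑ {n} (λ _ → 3) ⟨
  sumF {n} (λ _ → 3)
    ≡⟨ sumF-const n 3 ⟩
  n * 3 ∎
  where
  open ≡-Reasoning
  e : Fin n → Fin n → ℕ
  e u v = indicator (adj G u v ∧ (toℕ u <ᵇ toℕ v))
  double : numEdges G ≡ ℕΣ.∑ (λ u → ℕΣ.∑ (e u))
  double = trans (sumF-∑ (λ u → sumF (e u))) (ℕΣ.∑-cong (λ u → sumF-∑ (e u)))
  both : ∀ u v → e u v + e v u ≡ indicator (adj G u v)
  both u v rewrite symmetric G v u with adj G u v in uv
  ... | false = refl
  ... | true  = one {toℕ u <ᵇ toℕ v} {toℕ v <ᵇ toℕ u} (<ᵇ-xor {toℕ u} {toℕ v} λ eq → loop (toℕ-injective eq) uv)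
    where
    loop : ∀ {u v} → u ≡ v → adj G u v ≡ true → ⊥
    loop {u} refl uu with trans (sym uu) (irrefl G u)
    ... | ()
    one : ∀ {s t} → s xor t ≡ true → indicator s + indicator t ≡ 1
    one {false} {true}  _ = refl
    one {true}  {false} _ = refl
  row : ∀ u → ℕΣ.∑ (e u) + ℕΣ.∑ (λ v → e v u) ≡ 3
  row u = begin
    ℕΣ.∑ (e u) + ℕΣ.∑ (λ v → e v u) ≡⟨ ℕΣ.∑-∙ (e u) (λ v → e v u) ⟨
    ℕΣ.∑ (λ v → e u v + e v u)      ≡⟨ ℕΣ.∑-cong (both u) ⟩
    ℕΣ.∑ (indicator ∘ adj G u)      ≡⟨ sumF-∑ (indicator ∘ adj G u) ⟨
    degree G u                      ≡⟨ cubic u ⟩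
    3                               ∎

third-vertex : ∀ {n} → 2 < n → (u v : Fin n) → ∃ λ x → u ≢ x × v ≢ x
third-vertex (s≤s (s≤s (s≤s z≤n))) u v with any? (λ x → ¬? (u ≟ x) ×-dec ¬? (v ≟ x))
... | yes found = found
... | no none   = ⊥-elim (clash (taken zero) (taken (suc zero)) (taken (suc (suc zero))))
  where
  taken : ∀ x → u ≡ x ⊎ v ≡ x
  taken x with u ≟ x | v ≟ x
  ... | yes eq | _      = inj₁ eq
  ... | no _   | yes eq = inj₂ eq
  ... | no u≢x | no v≢x = contradiction (x , u≢x , v≢x) none
  clash : u ≡ zero ⊎ v ≡ zero → u ≡ suc zero ⊎ v ≡ suc zero →
          u ≡ suc (suc zero) ⊎ v ≡ suc (suc zero) → ⊥
  clash (inj₁ refl) (inj₂ refl) (inj₁ ())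
  clash (inj₁ refl) (inj₂ refl) (inj₂ ())
  clash (inj₂ refl) (inj₁ refl) (inj₁ ())
  clash (inj₂ refl) (inj₁ refl) (inj₂ ())

-- 2-connectivity only provides paths that avoid a vertex, so a third vertex is chosen as the one to
-- be avoided.
invariant⇒constant : ∀ {n} (G : SimpleGraph n) → TwoConnected G → Invariant⇒Constant G
invariant⇒constant G (2<n , reach) h inv u v with third-vertex 2<n u v
... | x , u≢x , v≢x = reach-invariant h (λ _ _ e → inv (T⇒≡ e)) (reach x u v u≢x v≢x)

-- Serves to decide between all faces being free and the existence of a digon.
all-or : ∀ {k} {P : Fin k → Set} {Q : Set} → (∀ i → P i ⊎ Q) → (∀ i → P i) ⊎ Q
all-or {zero}  each = inj₁ λ ()
all-or {suc k} each with each zero | all-or (each ∘ suc)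
... | inj₂ q | _      = inj₂ q
... | inj₁ _ | inj₂ q = inj₂ q
... | inj₁ p | inj₁ ps = inj₁ λ { zero → p ; (suc i) → ps i }

-- Selecting a list of cycles from a family

module _ {n} {G : SimpleGraph n} where

  collect : ∀ {k} → (Fin k → Bool) → (Fin k → Cycle G) → List (Cycle G)
  collect {zero}  keep C = []
  collect {suc k} keep C = if keep zero then C zero ∷ rest else rest
    where rest = collect (keep ∘ suc) (C ∘ suc)

  length-collect : ∀ {k} keep (C : Fin k → Cycle G) → length (collect keep C) ≡ countF keep
  length-collect {zero}  keep C = refl
  length-collect {suc k} keep C with keep zero
  ... | true  = cong suc (length-collect (keep ∘ suc) (C ∘ suc))
  ... | false = length-collect (keep ∘ suc) (C ∘ suc)

  edgeMult-collect : ∀ {k} keep (C : Fin k → Cycle G) u v →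
                     edgeMult (collect keep C) u v ≡ countF (λ i → keep i ∧ cedge (C i) u v)
  edgeMult-collect {zero}  keep C u v = refl
  edgeMult-collect {suc k} keep C u v with keep zero
  ... | true  = cong (indicator (cedge (C zero) u v) +_) (edgeMult-collect (keep ∘ suc) (C ∘ suc) u v)
  ... | false = edgeMult-collect (keep ∘ suc) (C ∘ suc) u v

-- The replacement cover, counted by kinds of faces

-- How a face lies relative to a centre whose neighbours carry three colours.
data Kind : Set where
  centre : Kind
  ring   : Fin 3 → Kind
  outer  : Kind

inRing : Fin 3 → Kind → Bool
inRing c centre    = false
inRing c (ring c′) = does (c′ ≟ c)
inRing c outer     = false

isCentre isOuter : Kind → Bool
isCentre centre   = true
isCentre (ring _) = false
isCentre outer    = false
isOuter centre    = false
isOuter (ring _)  = false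
isOuter outer     = true

Compatible : Kind → Kind → Set
Compatible centre   (ring _)  = ⊤
Compatible centre   _         = ⊥
Compatible (ring c) (ring c′) = c ≢ c′
Compatible (ring c) _         = ⊤
Compatible outer    centre    = ⊥
Compatible outer    _         = ⊤

inStar : Fin 3 → Kind → Bool
inStar c k = isCentre k ∨ inRing c k

-- The number of new cycles through an edge between faces of these kinds: one for each star that
-- contains exactly one of its sides, and one for each side that is kept as a face.
multiplicity : Kind → Kind → ℕ
multiplicity k k′ = separated zero + (separated (suc zero) + (separated (suc (suc zero))
                    + (indicator (isOuter k) + indicator (isOuter k′))))
  where
  separated : Fin 3 → ℕ
  separated c = indicator (inStar c k xor inStar c k′)

-- An edge between the centre and colour `c` is inner to the star of `c` and bounds the two other
-- stars. An edge between two colours bounds their two stars, an edge between colour `c` and an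
-- outer face bounds the star of `c` and that face, and an edge between outer faces bounds both.
multiplicity-two : ∀ k k′ → Compatible k k′ → multiplicity k k′ ≡ 2
multiplicity-two centre (ring zero)             _ = refl
multiplicity-two centre (ring (suc zero))       _ = refl
multiplicity-two centre (ring (suc (suc zero))) _ = refl
multiplicity-two (ring zero)             centre _ = refl
multiplicity-two (ring (suc zero))       centre _ = refl
multiplicity-two (ring (suc (suc zero))) centre _ = refl
multiplicity-two (ring zero)             outer  _ = refl
multiplicity-two (ring (suc zero))       outer  _ = refl
multiplicity-two (ring (suc (suc zero))) outer  _ = refl
multiplicity-two outer (ring zero)              _ = refl
multiplicity-two outer (ring (suc zero))        _ = refl
multiplicity-two outer (ring (suc (suc zero)))  _ = refl
multiplicity-two outer outer                    _ = refl
multiplicity-two (ring zero) (ring zero)                         c≢c = contradiction refl c≢c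
multiplicity-two (ring zero) (ring (suc zero))                   _ = refl
multiplicity-two (ring zero) (ring (suc (suc zero)))             _ = refl
multiplicity-two (ring (suc zero)) (ring zero)                   _ = refl
multiplicity-two (ring (suc zero)) (ring (suc zero))             c≢c = contradiction refl c≢c
multiplicity-two (ring (suc zero)) (ring (suc (suc zero)))       _ = refl
multiplicity-two (ring (suc (suc zero))) (ring zero)             _ = refl
multiplicity-two (ring (suc (suc zero))) (ring (suc zero))       _ = refl
multiplicity-two (ring (suc (suc zero))) (ring (suc (suc zero))) c≢c = contradiction refl c≢c

-- Faces, their boundaries, and stars of faces as cycles

module Sphere {n} (G : SimpleGraph n) (R : RotationSystem G) (cubic : Cubic G) (origin : Fin n)
  (Φ : Faces G R) (euler : n + Faces.m Φ ≡ 2 + numEdges G) (connected : Invariant⇒Constant G)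
  (no-cut-vertex : ∀ x u v → u ≢ x → v ≢ x → ReachIn (avoid x) (adj G) u v) where

  open Rotation G R cubic public
  open Faces Φ public
  open CutLemma G R cubic origin Φ euler connected using (cut; crosses; left; right; ∂) public

  _≟ᵈ_ : (d e : Dart n) → Dec (d ≡ e)
  _≟ᵈ_ = ≡-dec _≟_ _≟_

  uncrossed : ∀ ks {u v} → All (λ k → (u , v) ≢ k × (v , u) ≢ k) ks → crosses ks u v ≡ false
  uncrossed ks {u} {v} apart = ⨁-false ks λ {k} k∈ → ≢true⇒≡false λ same →
    [ proj₁ (All.lookup apart k∈) , proj₂ (All.lookup apart k∈) ]′ (sameEdge⁻ {k = k} {u} {v} same)

  -- For a face through which the closed dual walk `ks` does not pass: the cut function `ψ` will
  -- then be constant around it.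
  uncrossed-face : ∀ {ks i} → All (λ k → left k ≢ i × right k ≢ i) ks →
                   ∀ {u v} → face u v ≡ i → crosses ks u v ≡ false
  uncrossed-face {ks} apart {u} {v} refl = uncrossed ks
    (All.map (λ (l , r) → (λ eq → l (sym (cong left eq))) , (λ eq → r (sym (cong right eq)))) apart)

  -- If both sides were one face, the single dart would be a closed dual walk and hence a cut, that
  -- is, a bridge. But after leaving `u` along another edge one reaches `v` without returning to
  -- `u`.
  left≢right : ∀ {u v} → u — v → face u v ≢ face v u
  left≢right {u} {v} e eq with cut {(u , v) ∷ []} (e ∷ [])
    (λ φ → trans (xor-identityʳ _) (trans (cong (λ i → φ (face u v) xor φ i) (sym eq)) (xor-same (φ (face u v)))))
  ... | ψ , agree with trans (sym (agree e)) (trans (cong (_xor ψ v) ψu≡ψv) (xor-same (ψ v)))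
    where
    open ≡-Reasoning
    away : ∀ {p q} → p ≢ u ⊎ q ≢ v → p ≢ v ⊎ q ≢ u → p — q → ψ p ≡ ψ q
    away {p} {q} ne ne′ pq = xor-false⇒≡ (trans (agree pq) (uncrossed ((u , v) ∷ []) {p} {q} ((
      (λ { refl → [ (λ f → f refl) , (λ f → f refl) ]′ ne }) ,
      (λ { refl → [ (λ f → f refl) , (λ f → f refl) ]′ ne′ })) ∷ [])))
    ψu≡ψv : ψ u ≡ ψ v
    ψu≡ψv = begin
      ψ u         ≡⟨ away (inj₂ (r≢ e)) (inj₁ (—-≢ e)) (r— e) ⟩
      ψ (r u v)   ≡⟨ reach-invariant ψ (λ p≢ q≢ pq → away (inj₁ (avoid-≢ p≢)) (inj₂ (avoid-≢ q≢)) (T⇒≡ pq))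
                       (no-cut-vertex u (r u v) v (≢-sym (—-≢ (r— e))) (≢-sym (—-≢ e))) ⟩
      ψ v         ∎
  ...   | crosses≡false with trans (sym (cong (_xor false) (sameEdge-refl u v))) crosses≡false
  ...     | ()

  face-iter : ∀ k {d} → IsDart d → left (iter f k d) ≡ left d
  face-iter zero    e = refl
  face-iter (suc k) e = trans (face-next (iter-dart k e)) (face-iter k e)

  -- Walk around the face, starting behind the exceptional dart (a , b).
  face-walk : ∀ {_~_ : Fin n → Fin n → Set} → IsEquivalence _~_ → ∀ {a b i} → a — b → face a b ≡ i →
              (∀ {u v} → u — v → face u v ≡ i → (u , v) ≢ (a , b) → u ~ v) →
              ∀ {u v} → u — v → face u v ≡ i → b ~ u
  face-walk {_~_} eqv {a} {b} {i} ab ab∈ resp {u} {v} uv uv∈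
    with orbit (f-dart ab) uv (trans (face-next ab) (trans ab∈ (sym uv∈)))
  ... | k , eq = subst (λ d → b ~ proj₁ d) eq (walk k)
    where
    open IsEquivalence eqv using () renaming (refl to ~-refl; trans to ~-trans)
    walk : ∀ k → b ~ proj₁ (iter f k (f (a , b)))
    walk zero = ~-refl
    walk (suc k) with iter f k (f (a , b)) ≟ᵈ (a , b)
    ... | yes eq = subst (λ d → b ~ proj₂ d) (sym eq) ~-refl
    ... | no neq = ~-trans (walk k) (resp (iter-dart k (f-dart ab))
                     (trans (face-iter k (f-dart ab)) (trans (face-next ab) ab∈)) neq)

  corner≢ : ∀ {v u} → v — u → face u v ≢ face (r v u) v
  corner≢ e eq = left≢right (r— e) (trans (face-next (—-sym e)) eq)

  boundary : (Fin m → Bool) → Fin n → Fin n → Bool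
  boundary S u v = adj G u v ∧ (S (face u v) xor S (face v u))

  boundary-sym : ∀ S u v → boundary S u v ≡ boundary S v u
  boundary-sym S u v = cong₂ _∧_ (symmetric G u v) (xor-comm (S (face u v)) (S (face v u)))

  -- The number of changes in a cyclic sequence of three bits, hence 0 or 2; this makes every
  -- boundary in a cubic graph 2-regular.
  degree₃ : Bool → Bool → Bool → ℕ
  degree₃ a b c = indicator (c xor a) + (indicator (a xor b) + (indicator (b xor c) + 0))

  degree-boundary : ∀ S {v u} → v — u → degreeIn (boundary S) v ≡
    degree₃ (S (face u v)) (S (face (r v u) v)) (S (face (r v (r v u)) v))
  degree-boundary S {v} {u} e = begin
    degreeIn (boundary S) v
      ≡⟨ sumF-∑ (indicator ∘ boundary S v) ⟩
    ℕΣ.∑ (indicator ∘ boundary S v)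
      ≡⟨ ℕΣ.∑-support (around-unique e) (λ w w∉ → cong (λ b → indicator (b ∧ _)) (≢true⇒≡false (w∉ ∘ around-cover e))) ⟩
    foldr _+_ 0 (map (indicator ∘ boundary S v) (around v u))
      ≡⟨ cong₂ _+_ (at e (trans (cong (face v) (sym (r³≡ e))) (face-next (—-sym (r— (r— e))))))
          (cong₂ _+_ (at (r— e) (face-next (—-sym e))) (cong (_+ 0) (at (r— (r— e)) (face-next (—-sym (r— e)))))) ⟩
    degree₃ (S (face u v)) (S (face (r v u) v)) (S (face (r v (r v u)) v)) ∎
    where
    open ≡-Reasoning
    at : ∀ {w i} → v — w → face v w ≡ i → indicator (boundary S v w) ≡ indicator (S i xor S (face w v))
    at {w} vw refl = cong (λ b → indicator (b ∧ (S (face v w) xor S (face w v)))) vw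

  degree-0-or-2 : ∀ S v → degreeIn (boundary S) v ≡ 0 ⊎ degreeIn (boundary S) v ≡ 2
  degree-0-or-2 S v with neighbour v
  ... | u , e = [ inj₁ ∘ trans (degree-boundary S e) , inj₂ ∘ trans (degree-boundary S e) ]′
                (cases (S (face u v)) (S (face (r v u) v)) (S (face (r v (r v u)) v)))
    where
    cases : ∀ a b c → degree₃ a b c ≡ 0 ⊎ degree₃ a b c ≡ 2
    cases false false false = inj₁ refl
    cases false false true  = inj₂ refl
    cases false true  false = inj₂ refl
    cases false true  true  = inj₂ refl
    cases true  false false = inj₂ refl
    cases true  false true  = inj₂ refl
    cases true  true  false = inj₂ refl
    cases true  true  true  = inj₁ refl

  -- The face A together with pairwise non-adjacent faces P, each sharing exactly
  -- one edge with A, is bounded by a single cycle.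
  record Star (A : Fin m) (P : Fin m → Bool) : Set where
    field
      touches     : ∀ {B} → P B ≡ true → ∃₂ λ a b → a — b × face a b ≡ A × face b a ≡ B
      once        : ∀ {u v u′ v′} → u — v → u′ — v′ → face u v ≡ A → face u′ v′ ≡ A →
                    P (face v u) ≡ true → face v u ≡ face v′ u′ → (u , v) ≡ (u′ , v′)
      independent : ∀ {u v} → u — v → P (face u v) ≡ true → P (face v u) ≡ false

  star : Fin m → (Fin m → Bool) → Fin m → Bool
  star A P i = does (i ≟ A) ∨ P i

  module _ {A P} (S : Star A P) where
    open Star S

    private
      in-star : Fin m → Bool
      in-star = star A P

      A∈ : in-star A ≡ true
      A∈ = cong (_∨ P A) (dec-true (A ≟ A) refl)

      P⊆ : ∀ {B} → P B ≡ true → in-star B ≡ true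
      P⊆ {B} p = trans (cong (does (B ≟ A) ∨_) p) (∨-zeroʳ _)

      ∉star : ∀ {B} → B ≢ A → P B ≡ false → in-star B ≡ false
      ∉star {B} B≢A p = cong₂ _∨_ (dec-false (B ≟ A) B≢A) p

      Used : Fin n → Bool
      Used w = 0 <ᵇ degreeIn (boundary in-star) w

      Reach : Fin n → Fin n → Set
      Reach = ReachIn Used (boundary in-star)

      -- Reachability along the boundary is reflexive only at its own vertices; adding equality
      -- turns it into the equivalence that `face-walk` requires.
      _~_ : Fin n → Fin n → Set
      u ~ v = u ≡ v ⊎ Reach u v

      ~-equivalence : IsEquivalence _~_
      ~-equivalence = record
        { refl  = inj₁ refl
        ; sym   = λ { (inj₁ refl) → inj₁ refl ; (inj₂ p) → inj₂ (reach-sym (boundary-sym in-star) p) }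
        ; trans = λ { (inj₁ refl) q → q ; (inj₂ p) (inj₁ refl) → inj₂ p
                    ; (inj₂ p) (inj₂ q) → inj₂ (reach-trans p q) } }

      open IsEquivalence ~-equivalence using () renaming (sym to ~-sym; trans to ~-trans)

      used : ∀ {u v} → boundary in-star u v ≡ true → T (Used u)
      used {u} {v} e = <⇒<ᵇ (countF-unique {p = boundary in-star u} {v ∷ []} ([] ∷ []) (e ∷ []))

      edge-~ : ∀ {u v} → u — v → in-star (face u v) ≡ true → in-star (face v u) ≡ false → u ~ v
      edge-~ {u} {v} e p q = inj₂ (step (used uv) (≡⇒T uv)
                                     (here (used (trans (boundary-sym in-star v u) uv))))
        where
        uv : boundary in-star u v ≡ true
        uv = cong₂ _∧_ e (cong₂ _xor_ p q)

      -- The walk around the leaf starts behind its one edge with `A`. Every other edge of the leaf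
      -- is on the boundary of the star, since its far side is not `A` by `once` and not a leaf by
      -- `independent`.
      leaf-~ : ∀ {a b} → a — b → face a b ≡ A → P (face b a) ≡ true →
               ∀ {u v} → u — v → face u v ≡ face b a → a ~ u
      leaf-~ {a} {b} ab ab∈ Pba = face-walk ~-equivalence (—-sym ab) refl other
        where
        other : ∀ {u v} → u — v → face u v ≡ face b a → (u , v) ≢ (b , a) → u ~ v
        other {u} {v} uv uv∈ ne = edge-~ uv (P⊆ Puv) (∉star not-A (independent uv Puv))
          where
          Puv : P (face u v) ≡ true
          Puv = trans (cong P uv∈) Pba
          not-A : face v u ≢ A
          not-A vu∈ with once (—-sym uv) ab vu∈ ab∈ Puv uv∈
          ... | refl = ne refl

      base : ∃₂ λ a b → a — b × face a b ≡ A
      base = dart A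

      b₀ : Fin n
      b₀ = proj₁ (proj₂ base)

      centre-~ : ∀ {u v} → u — v → face u v ≡ A → b₀ ~ u
      centre-~ = face-walk ~-equivalence (proj₁ (proj₂ (proj₂ base))) (proj₂ (proj₂ (proj₂ base)))
        λ uv uv∈ _ → along uv uv∈
        where
        along : ∀ {u v} → u — v → face u v ≡ A → u ~ v
        along {u} {v} uv uv∈ with P (face v u) in p
        -- An edge between `A` and a leaf is inner to the star, but the way around the leaf joins
        -- its two ends.
        ... | true  = leaf-~ uv uv∈ p (—-sym uv) refl
        ... | false = edge-~ uv (trans (cong in-star uv∈) A∈)
                        (∉star (λ vu∈ → left≢right uv (trans uv∈ (sym vu∈))) p)

      member-~ : ∀ {u v} → u — v → in-star (face u v) ≡ true → b₀ ~ u
      member-~ {u} {v} uv p with face u v ≟ A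
      ... | yes uv∈ = centre-~ uv uv∈
      ... | no _ with touches p
      ...   | a , b , ab , ab∈ , ba∈ =
        ~-trans (centre-~ ab ab∈) (leaf-~ ab ab∈ (trans (cong P ba∈) p) uv (sym ba∈))

      on-boundary : ∀ {u} → degreeIn (boundary in-star) u ≡ 2 → b₀ ~ u
      on-boundary {u} deg with any? (λ w → boundary in-star u w ≟ᵇ true)
      ... | no none with trans (sym deg) (countF-exact [] (λ w e → contradiction (w , e) none) [])
      ...   | ()
      on-boundary {u} deg | yes (w , e) with in-star (face u w) in p
      ... | true  = member-~ (∧-conicalˡ _ _ e) p
      ... | false = member-~ (f-dart (—-sym uw)) (trans (cong in-star (face-next (—-sym uw))) q)
        where
        uw : u — w
        uw = ∧-conicalˡ _ _ e
        q : in-star (face w u) ≡ true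
        q = ∧-conicalʳ (adj G u w) _ e

      -- At an end of an edge of `A`, the two other faces are adjacent and hence not both leaves,
      -- while `A` itself is in the star; so membership changes around this vertex.
      nonempty : ∃ λ v → degreeIn (boundary in-star) v ≡ 2
      nonempty with base
      ... | a , b , ab , ab∈ = b , trans (degree-boundary in-star ba)
          (two (trans (cong in-star ab∈) A∈) not-both)
        where
        ba = —-sym ab
        r₁ = r b a
        r₂ = r b r₁
        c₁≢A : face r₁ b ≢ A
        c₁≢A eq = corner≢ ba (trans ab∈ (sym eq))
        c₂≢A : face r₂ b ≢ A
        c₂≢A eq = corner≢ (r— (r— ba)) (trans eq (trans (sym ab∈) (cong (λ w → face w b) (sym (r³≡ ba)))))
        not-both : in-star (face r₁ b) ≡ false ⊎ in-star (face r₂ b) ≡ false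
        not-both with P (face r₁ b) ≟ᵇ true
        ... | no ¬p = inj₁ (∉star c₁≢A (≢true⇒≡false ¬p))
        ... | yes p = inj₂ (∉star c₂≢A (independent (r— (r— ba)) (trans (cong P (face-next (—-sym (r— ba)))) p)))
        two : ∀ {x y z} → x ≡ true → y ≡ false ⊎ z ≡ false → degree₃ x y z ≡ 2
        two {z = false} refl (inj₁ refl) = refl
        two {z = true}  refl (inj₁ refl) = refl
        two {y = false} refl (inj₂ refl) = refl
        two {y = true}  refl (inj₂ refl) = refl

    starCycle : Cycle G
    starCycle = record
      { cedge = boundary in-star
      ; csym = boundary-sym in-star
      ; csub = λ u v e → ≡⇒T (∧-conicalˡ _ _ (T⇒≡ e))
      ; cdeg = degree-0-or-2 in-star
      ; cnonempty = nonempty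
      ; cconnected = λ u v du dv → reach (≡⇒T (cong (0 <ᵇ_) du)) (~-trans (~-sym (on-boundary du)) (on-boundary dv))
      }
      where
      reach : ∀ {u v} → T (Used u) → u ~ v → Reach u v
      reach p (inj₁ refl) = here p
      reach p (inj₂ q)    = q

  -- Free faces

  Free : Fin m → Set
  Free A = ∀ {u v u′ v′} → u — v → u′ — v′ → face u v ≡ A → face u′ v′ ≡ A →
           face v u ≡ face v′ u′ → (u , v) ≡ (u′ , v′)

  -- A closed walk of length two in the dual, to which the cut lemma applies.
  record Digon : Set where
    field
      {a b c d} : Fin n
      ab        : a — b
      cd        : c — d
      lefts     : face a b ≡ face c d
      rights    : face b a ≡ face d c
      distinct  : (a , b) ≢ (c , d)

  free-or-digon : ∀ A → Free A ⊎ (Σ Digon λ D → face (Digon.a D) (Digon.b D) ≡ A)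
  free-or-digon A with any? (λ u → any? (λ v → any? (λ u′ → any? (λ v′ →
      (adj G u v ≟ᵇ true) ×-dec (adj G u′ v′ ≟ᵇ true) ×-dec (face u v ≟ A) ×-dec (face u′ v′ ≟ A)
      ×-dec (face v u ≟ face v′ u′) ×-dec ¬? ((u , v) ≟ᵈ (u′ , v′))))))
  ... | yes (u , v , u′ , v′ , uv , uv′ , i , i′ , j , ne) =
    inj₂ (record { ab = uv ; cd = uv′ ; lefts = trans i (sym i′) ; rights = j ; distinct = ne } , i)
  ... | no none = inj₁ free
    where
    free : Free A
    free {u} {v} {u′} {v′} uv uv′ i i′ j with (u , v) ≟ᵈ (u′ , v′)
    ... | yes eq = eq
    ... | no ne  = contradiction (u , v , u′ , v′ , uv , uv′ , i , i′ , j , ne) none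

  -- The same two edges seen from across the cut: the distinguished end is now `b`.
  reverse : Digon → Digon
  reverse D = record
    { ab = —-sym ab ; cd = —-sym cd ; lefts = rights ; rights = lefts
    ; distinct = λ eq → distinct (cong₂ _,_ (cong proj₂ eq) (cong proj₁ eq)) }
    where open Digon D

  module _ (D : Digon) where
    open Digon D

    digonEdges : List (Dart n)
    digonEdges = (a , b) ∷ (c , d) ∷ []

    digon-cut : ∃ λ ψ → ∀ {u v} → u — v → ψ u xor ψ v ≡ crosses digonEdges u v
    digon-cut = cut (ab ∷ cd ∷ []) λ φ → begin
      ∂ φ (a , b) xor (∂ φ (c , d) xor false) ≡⟨ cong (∂ φ (a , b) xor_) (xor-identityʳ _) ⟩
      ∂ φ (a , b) xor ∂ φ (c , d)             ≡⟨ cong₂ (λ i j → (φ i xor φ j) xor ∂ φ (c , d)) lefts rights ⟩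
      ∂ φ (c , d) xor ∂ φ (c , d)             ≡⟨ xor-same (∂ φ (c , d)) ⟩
      false                                   ∎
      where open ≡-Reasoning

    crosses⁻ : ∀ {u v} → crosses digonEdges u v ≡ true →
               sameEdge (a , b) u v ≡ true ⊎ sameEdge (c , d) u v ≡ true
    crosses⁻ {u} {v} eq with sameEdge (a , b) u v | sameEdge (c , d) u v
    ... | true  | _     = inj₁ refl
    ... | false | true  = inj₂ refl

    ab-crosses : crosses digonEdges a b ≡ true
    ab-crosses = cong₂ _xor_ (sameEdge-refl a b) (cong (_xor false) (≢true⇒≡false λ same →
      [ distinct , (λ eq → left≢right ab (trans lefts (sym (cong left eq)))) ]′
      (sameEdge⁻ {k = c , d} {a} {b} same)))

    cd-crosses : crosses digonEdges c d ≡ true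
    cd-crosses = cong₂ _xor_ (≢true⇒≡false λ same →
        [ distinct ∘ sym , (λ eq → left≢right cd (trans (sym lefts) (sym (cong left eq)))) ]′
        (sameEdge⁻ {k = a , b} {c} {d} same))
      (cong (_xor false) (sameEdge-refl c d))

    record Side (U : Fin n → Bool) : Set where
      field
        a∈ : U a ≡ true
        δU : ∀ {u v} → u — v → U u xor U v ≡ crosses digonEdges u v

  crosses-reverse : ∀ D u v → crosses (digonEdges (reverse D)) u v ≡ crosses (digonEdges D) u v
  crosses-reverse D u v = cong₂ _xor_ (∨-comm (does (u ≟ b) ∧ does (v ≟ a)) _)
    (cong (_xor false) (∨-comm (does (u ≟ d) ∧ does (v ≟ c)) _))
    where open Digon D

  same-value : {A : Set} (h : Fin n → A) → IsEquivalence (λ u v → h u ≡ h v)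
  same-value h = On.isEquivalence h isEquivalence

  -- The third face C at the end a ∈ U of the edge ab stays inside U.  If C is
  -- not free, a second edge shared by C with some face cuts off a smaller side
  -- that does not contain a.
  free-inside : ∀ k D {U} → Side D U → countF U < k →
                ∃ λ X → Free X × (∀ {u v} → u — v → face u v ≡ X → U u ≡ true)
  free-inside (suc k) D {U} side size< = [ found , smaller ]′ (free-or-digon C)
    where
    open Digon D
    open Side side
    C : Fin m
    C = face (r a b) a
    C≢left : face a b ≢ C
    C≢left eq = corner≢ (r— ab) (trans (sym eq)
      (trans (cong (face a) (sym (r³≡ ab))) (face-next (—-sym (r— (r— ab))))))
    C≢right : face b a ≢ C
    C≢right = corner≢ ab
    C≢cd : face c d ≢ C
    C≢cd = C≢left ∘ trans lefts
    C≢dc : face d c ≢ C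
    C≢dc = C≢right ∘ trans rights
    -- `C` is the third face at `a`, hence neither face of `D`; no edge around it is crossed, and
    -- `U` keeps the value it has at `a`.
    C⊆U : ∀ {u v} → u — v → face u v ≡ C → U u ≡ true
    C⊆U uv uv∈ = trans (sym (face-walk (same-value U) (—-sym (r— ab)) refl
      (λ {p} {q} pq pq∈ _ → xor-false⇒≡ (trans (δU pq)
        (uncrossed-face {digonEdges D} ((C≢left , C≢right) ∷ (C≢cd , C≢dc) ∷ []) {p} {q} pq∈)))
      uv uv∈)) a∈
    C⊆U′ : ∀ {u v} → u — v → face u v ≡ C → U v ≡ true
    C⊆U′ uv uv∈ = C⊆U (f-dart uv) (trans (face-next uv) uv∈)

    Goal : Set
    Goal = ∃ λ X → Free X × (∀ {u v} → u — v → face u v ≡ X → U u ≡ true)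

    found : Free C → Goal
    found free = C , free , C⊆U

    smaller : (Σ Digon λ D₁ → face (Digon.a D₁) (Digon.b D₁) ≡ C) → Goal
    smaller (D₁ , xy∈) with digon-cut D₁
    ... | ψ , δψ = recurse (W x) refl
      where
      open Digon D₁ using () renaming (a to x; b to y; c to z; d to w; ab to xy; cd to zw;
                                       lefts to lefts₁; rights to rights₁)
      zw∈ : face z w ≡ C
      zw∈ = trans (sym lefts₁) xy∈
      C′ : Fin m
      C′ = face y x
      -- Adding `ψ a` normalises the cut of `D₁` so that `a` lies outside; the intersection with `U`
      -- is then strictly smaller than `U`.
      W : Fin n → Bool
      W u = ψ u xor ψ a
      δW : ∀ {u v} → u — v → W u xor W v ≡ crosses (digonEdges D₁) u v
      δW {u} {v} uv = trans (xor-interchange (ψ u) (ψ a) (ψ v) (ψ a))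
        (trans (cong ((ψ u xor ψ v) xor_) (xor-same (ψ a))) (trans (xor-identityʳ _) (δψ uv)))
      a∉W : W a ≡ false
      a∉W = xor-same (ψ a)
      U₁ : Fin n → Bool
      U₁ u = U u ∧ W u

      a-ends : ∀ {u v} → sameEdge (a , b) u v ≡ true → W u ≡ true → W v ≡ true → ⊥
      a-ends {u} {v} same u∈ v∈ with sameEdge⁻ {k = a , b} {u} {v} same
      ... | inj₁ refl with trans (sym u∈) a∉W
      ...   | ()
      a-ends same u∈ v∈ | inj₂ refl with trans (sym v∈) a∉W
      ...   | ()

      U₁-equal : ∀ {u v} → u — v → crosses (digonEdges D₁) u v ≡ false →
                 (W u ≡ true → W v ≡ true → sameEdge (c , d) u v ≡ true → ⊥) → U₁ u ≡ U₁ v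
      U₁-equal {u} {v} uv uncr not-cd = [ inside , outside ]′ (true-or-false (W u))
        where
        Wu≡Wv : W u ≡ W v
        Wu≡Wv = xor-false⇒≡ (trans (δW uv) uncr)
        outside : W u ≡ false → U₁ u ≡ U₁ v
        outside Wu = trans (trans (cong (U u ∧_) Wu) (∧-zeroʳ (U u)))
          (sym (trans (cong (U v ∧_) (trans (sym Wu≡Wv) Wu)) (∧-zeroʳ (U v))))
        inside : W u ≡ true → U₁ u ≡ U₁ v
        inside Wu = cong₂ _∧_ (xor-false⇒≡ (trans (δU uv) (≢true⇒≡false λ cr →
          [ (λ same → a-ends same Wu Wv) , not-cd Wu Wv ]′ (crosses⁻ D {u} {v} cr)))) Wu≡Wv
          where
          Wv : W v ≡ true
          Wv = trans (sym Wu≡Wv) Wu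

      -- Around a face other than `C` and `C′` no edge of `D₁` occurs, and of the two edges of `D`
      -- only `cd` could change `U₁`, because `a` is outside `W`. If `cd` is met at most as the
      -- starting edge, going all the way round shows that `U₁` does not change there either.
      loop : ∀ {p q} → p — q → face p q ≢ C → face p q ≢ C′ →
             (∀ {u v} → u — v → face u v ≡ face p q → (u , v) ≢ (p , q) → sameEdge (c , d) u v ≡ true → ⊥) →
             U₁ q ≡ U₁ p
      loop {p} {q} pq ≢C ≢C′ only = face-walk (same-value U₁) pq refl
        (λ {u} {v} uv uv∈ ne → U₁-equal uv
          (uncrossed-face {digonEdges D₁}
            (((λ eq → ≢C (trans (sym eq) xy∈)) , (λ eq → ≢C′ (sym eq)))
            ∷ ((λ eq → ≢C (trans (sym eq) zw∈)) , (λ eq → ≢C′ (trans (sym eq) (sym rights₁)))) ∷ [])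
            {u} {v} uv∈)
          (λ _ _ → only uv uv∈ ne)) pq refl

      -- Neither side of `cd` is `C` and at most one is `C′`, so a side remains around which `loop`
      -- can go.
      U₁c≡U₁d : U₁ c ≡ U₁ d
      U₁c≡U₁d with face c d ≟ C′
      ... | no ≢C′ = sym (loop cd C≢cd ≢C′ λ {u} {v} _ uv∈ ne same →
              [ ne , (λ eq → left≢right cd (trans (sym uv∈) (cong right eq))) ]′
              (sameEdge⁻ {k = c , d} {u} {v} same))
      ... | yes ≡C′ = loop (—-sym cd) C≢dc (λ eq → left≢right cd (trans ≡C′ (sym eq)))
              λ {u} {v} _ uv∈ ne same →
              [ (λ eq → left≢right cd (trans (sym (cong left eq)) uv∈))
              , (λ eq → ne (cong₂ _,_ (cong proj₂ eq) (cong proj₁ eq))) ]′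
              (sameEdge⁻ {k = c , d} {u} {v} same)

      -- With both ends in `W`, `U₁` would coincide with `U` at `c` and `d`, yet `U` changes across
      -- `cd`. Hence only the edges of `D₁` bound `U₁`.
      c∉W : W c ≡ true → W d ≡ true → ⊥
      c∉W c∈ d∈ with trans (sym (cd-crosses D)) (trans (sym (δU cd))
        (trans (cong₂ _xor_ (sym (∧-identityʳ (U c))) (sym (∧-identityʳ (U d))))
          (trans (cong₂ (λ s t → (U c ∧ s) xor (U d ∧ t)) (sym c∈) (sym d∈))
            (trans (cong (_xor U₁ d) U₁c≡U₁d) (xor-same (U₁ d))))))
      ... | ()

      not-cd : ∀ {u v} → W u ≡ true → W v ≡ true → sameEdge (c , d) u v ≡ true → ⊥
      not-cd {u} {v} u∈ v∈ same with sameEdge⁻ {k = c , d} {u} {v} same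
      ... | inj₁ refl = c∉W u∈ v∈
      ... | inj₂ refl = c∉W v∈ u∈

      ends⊆U : ∀ {u v} → crosses (digonEdges D₁) u v ≡ true → U u ≡ true × U v ≡ true
      ends⊆U {u} {v} cr with crosses⁻ D₁ {u} {v} cr
      ... | inj₁ same with sameEdge⁻ {k = x , y} {u} {v} same
      ...   | inj₁ refl = C⊆U xy xy∈ , C⊆U′ xy xy∈
      ...   | inj₂ refl = C⊆U′ xy xy∈ , C⊆U xy xy∈
      ends⊆U {u} {v} cr | inj₂ same with sameEdge⁻ {k = z , w} {u} {v} same
      ...   | inj₁ refl = C⊆U zw zw∈ , C⊆U′ zw zw∈
      ...   | inj₂ refl = C⊆U′ zw zw∈ , C⊆U zw zw∈

      δU₁ : ∀ {u v} → u — v → U₁ u xor U₁ v ≡ crosses (digonEdges D₁) u v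
      δU₁ {u} {v} uv with crosses (digonEdges D₁) u v ≟ᵇ true
      ... | yes cr = trans (cong₂ _xor_ (cong (_∧ W u) (proj₁ (ends⊆U {u} {v} cr)))
                                        (cong (_∧ W v) (proj₂ (ends⊆U {u} {v} cr)))) (δW uv)
      ... | no ¬cr = trans (cong (_xor U₁ v) (U₁-equal uv (≢true⇒≡false ¬cr) not-cd))
                           (trans (xor-same (U₁ v)) (sym (≢true⇒≡false ¬cr)))

      shrink : countF U₁ < k
      shrink = ≤-trans (countF-strict a (λ u → ∧-conicalˡ (U u) (W u))
                         (trans (cong (U a ∧_) a∉W) (∧-zeroʳ (U a))) a∈) (s≤s⁻¹ size<)

      lift : (∃ λ X → Free X × (∀ {u v} → u — v → face u v ≡ X → U₁ u ≡ true)) → Goal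
      lift (X , free , X⊆) = X , free , λ uv uv∈ → ∧-conicalˡ _ _ (X⊆ uv uv∈)

      -- `W` changes across `xy`, so exactly one end of that edge lies in `U₁`; the digon is
      -- oriented so as to start there.
      recurse : ∀ s → W x ≡ s → Goal
      recurse true  Wx = lift (free-inside k D₁ {U₁} (record { a∈ = cong₂ _∧_ (C⊆U xy xy∈) Wx ; δU = δU₁ }) shrink)
      recurse false Wx = lift (free-inside k (reverse D₁) {U₁} (record
        { a∈ = cong₂ _∧_ (C⊆U′ xy xy∈) (trans (cong (_xor W y) (sym Wx)) (trans (δW xy) (ab-crosses D₁)))
        ; δU = λ {u} {v} uv → trans (δU₁ uv) (sym (crosses-reverse D₁ u v)) }) shrink)

  Disjoint : Fin m → Fin m → Set
  Disjoint X X′ = ∀ {u v v′} → u — v → u — v′ → face u v ≡ X → face u v′ ≢ X′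

  -- One side of the cut is searched from `a`, the other from `b` by means of `reverse`; faces found
  -- on opposite sides have no vertex in common.
  two-free-faces : Digon → ∃₂ λ X X′ → Free X × Free X′ × Disjoint X X′
  two-free-faces D with digon-cut D
  ... | ψ , δψ = conclude
      (free-inside (suc (countF U)) D {U}
        (record { a∈ = cong not (xor-same (ψ a)) ; δU = λ {u} {v} uv → trans (not-xor-not (ψ u xor ψ a) _) (δφ uv) })
        (n<1+n _))
      (free-inside (suc (countF U′)) (reverse D) {U′}
        (record { a∈ = trans (xor-comm (ψ b) (ψ a)) (trans (δψ ab) (ab-crosses D))
                ; δU = λ {u} {v} uv → trans (δφ uv) (sym (crosses-reverse D u v)) })
        (n<1+n _))
    where
    open Digon D
    U′ U : Fin n → Bool
    U′ u = ψ u xor ψ a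
    U u = not (U′ u)
    not-xor-not : ∀ s t → not s xor not t ≡ s xor t
    not-xor-not false false = refl
    not-xor-not false true  = refl
    not-xor-not true  false = refl
    not-xor-not true  true  = refl
    δφ : ∀ {u v} → u — v → U′ u xor U′ v ≡ crosses (digonEdges D) u v
    δφ {u} {v} uv = trans (xor-interchange (ψ u) (ψ a) (ψ v) (ψ a))
      (trans (cong ((ψ u xor ψ v) xor_) (xor-same (ψ a))) (trans (xor-identityʳ _) (δψ uv)))
    conclude : (∃ λ X → Free X × (∀ {u v} → u — v → face u v ≡ X → U u ≡ true)) →
               (∃ λ X → Free X × (∀ {u v} → u — v → face u v ≡ X → U′ u ≡ true)) →
               ∃₂ λ X X′ → Free X × Free X′ × Disjoint X X′
    conclude (X , fX , X⊆) (X′ , fX′ , X′⊆) = X , X′ , fX , fX′ , disjoint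
      where
      disjoint : Disjoint X X′
      disjoint uv uv′ u∈X u∈X′ with trans (sym (cong not (X′⊆ uv′ u∈X′))) (X⊆ uv u∈X)
      ... | ()

  -- Adjacent faces, and the circle of neighbours of a free face

  Touch : Fin m → Fin m → Set
  Touch A B = ∃₂ λ u v → u — v × face u v ≡ A × face v u ≡ B

  touch? : ∀ A B → Dec (Touch A B)
  touch? A B = any? λ u → any? λ v → (adj G u v ≟ᵇ true) ×-dec (face u v ≟ A) ×-dec (face v u ≟ B)

  touch-sym : ∀ {A B} → Touch A B → Touch B A
  touch-sym (u , v , uv , i , j) = v , u , —-sym uv , j , i

  touch-≢ : ∀ {A B} → Touch A B → A ≢ B
  touch-≢ (u , v , uv , refl , refl) = left≢right uv

  touch-common-vertex : ∀ {A B} → Touch A B → ∃₂ λ u v → ∃ λ v′ → u — v × u — v′ × face u v ≡ A × face u v′ ≡ B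
  touch-common-vertex (u , v , uv , i , j) =
    u , v , r u v , uv , r— uv , i , trans (face-next (—-sym uv)) j

  source target : Dart n → Fin n
  source = proj₁
  target = proj₂

  module Boundary {A : Fin m} (free : Free A) {d₀ : Dart n} (d₀-dart : IsDart d₀) (d₀∈A : left d₀ ≡ A) where

    private
      abstract
        least-period : ∃ λ p → iter f (suc p) d₀ ≡ d₀ × (∀ {j} → j < p → iter f (suc j) d₀ ≢ d₀)
        least-period = least-witness {λ p → iter f (suc p) d₀ ≡ d₀} (λ p → iter f (suc p) d₀ ≟ᵈ d₀) {proj₁ (period d₀-dart)} (proj₂ (proj₂ (period d₀-dart)))

      -- `K` is the number of edges around `A`, and `p₀` is the last index in their numbering from
      -- `0`.
      p₀ K : ℕ
      p₀ = proj₁ least-period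
      K  = suc p₀

      ds : ℕ → Dart n
      ds t = iter f t d₀

      ds-dart : ∀ t → IsDart (ds t)
      ds-dart t = iter-dart t d₀-dart

      ds∈A : ∀ t → left (ds t) ≡ A
      ds∈A t = trans (face-iter t d₀-dart) d₀∈A

      opp : ℕ → Fin m
      opp t = right (ds t)

      opp≢A : ∀ t → A ≢ opp t
      opp≢A t eq = left≢right (ds-dart t) (trans (ds∈A t) eq)

      ds-distinct : ∀ {s t} → s < t → t < K → ds s ≢ ds t
      ds-distinct {s} {t} s<t t<K eq with t ∸ s in gap | m<n⇒0<n∸m s<t | iter-return d₀-dart s<t eq
      ... | suc j | _ | back = proj₂ (proj₂ least-period)
        (s≤s⁻¹ (≤-trans (s≤s (subst (_≤ t) gap (m∸n≤m t s))) t<K)) back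

      ds-injective : ∀ {s t} → s < K → t < K → ds s ≡ ds t → s ≡ t
      ds-injective {s} {t} s<K t<K eq with <-cmp s t
      ... | tri< s<t _ _ = contradiction eq (ds-distinct s<t t<K)
      ... | tri≈ _ s≡t _ = s≡t
      ... | tri> _ _ t<s = contradiction (sym eq) (ds-distinct t<s s<K)

      opp-injective : ∀ {s t} → s < K → t < K → opp s ≡ opp t → s ≡ t
      opp-injective {s} {t} s<K t<K eq =
        ds-injective s<K t<K (free (ds-dart s) (ds-dart t) (ds∈A s) (ds∈A t) eq)

      covered : ∀ {u v} → u — v → face u v ≡ A → ∃ λ t → t < K × ds t ≡ (u , v)
      covered uv uv∈ with orbit d₀-dart uv (trans d₀∈A (sym uv∈))
      ... | k , eq = k % K , m%n<n k K , trans (iter-% (proj₁ (proj₂ least-period)) k) eq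

      1<K : 1 < K
      1<K with p₀ | proj₁ (proj₂ least-period)
      ... | zero  | eq = ⊥-elim (—-≢ d₀-dart (sym (cong proj₁ eq)))
      ... | suc p | _  = s≤s (s≤s z≤n)

      walk : ∀ (ψ : Fin n → Bool) {s} e → (∀ {x} → s ≤ x → x < e + s → ψ (source (ds x)) ≡ ψ (target (ds x))) →
             ψ (source (ds s)) ≡ ψ (source (ds (e + s)))
      walk ψ zero    steps = refl
      walk ψ {s} (suc e) steps = trans (walk ψ e (λ s≤x x< → steps s≤x (<-trans x< (n<1+n _))))
                                       (steps (m≤n+m s e) ≤-refl)

      walk-to : ∀ (ψ : Fin n → Bool) {s t} → s ≤ t →
                (∀ {x} → s ≤ x → x < t → ψ (source (ds x)) ≡ ψ (target (ds x))) →
                ψ (source (ds s)) ≡ ψ (source (ds t))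
      walk-to ψ {s} {t} s≤t steps = subst (λ z → ψ (source (ds s)) ≡ ψ (source (ds z))) (m∸n+n≡m s≤t)
        (walk ψ (t ∸ s) (λ {x} s≤x x< → steps s≤x (subst (x <_) (m∸n+n≡m s≤t) x<)))

      abstract
        -- The closed dual curve through A, opp i and opp j separates opp p from opp q.
        noncrossing : ∀ {i p j q} → i < p → p < j → j < q → q < K →
                      Touch (opp i) (opp j) → ¬ Touch (opp p) (opp q)
        noncrossing {i} {p} {j} {q} i<p p<j j<q q<K (x , y , xy , xy∈ , yx∈) (u , v , uv , uv∈ , vu∈) =
          conclude (cut {ks} (ds-dart i ∷ xy ∷ ds-dart j ∷ []) closed)
          where
          ks : List (Dart n)
          ks = ds i ∷ (x , y) ∷ ds j ∷ []
          table : ∀ a b c → (a xor b) xor ((b xor c) xor ((a xor c) xor false)) ≡ false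
          table false false false = refl
          table false false true  = refl
          table false true  false = refl
          table false true  true  = refl
          table true  false false = refl
          table true  false true  = refl
          table true  true  false = refl
          table true  true  true  = refl
          closed : ∀ φ → ⨁ (∂ φ) ks ≡ false
          closed φ = trans
            (cong₂ _xor_ (cong (λ z → φ z xor φ (opp i)) (ds∈A i))
              (cong₂ _xor_ (cong₂ (λ z z′ → φ z xor φ z′) xy∈ yx∈)
                (cong (λ z → (φ z xor φ (opp j)) xor false) (ds∈A j))))
            (table (φ A) (φ (opp i)) (φ (opp j)))
          conclude : (∃ λ (ψ : Fin n → Bool) → ∀ {u v} → u — v → ψ u xor ψ v ≡ crosses ks u v) → ⊥
          conclude (ψ , δψ) = absurd
            where
            j<K : j < K
            j<K = <-trans j<q q<K
            p<K : p < K
            p<K = <-trans p<j j<K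
            i<K : i < K
            i<K = <-trans i<p p<K

            constant-on : ∀ {t} → t < K → t ≢ i → t ≢ j → ∀ {u v} → u — v → face u v ≡ opp t →
                          ψ (source (ds t)) ≡ ψ u
            constant-on {t} t<K t≢i t≢j = face-walk (same-value ψ) (—-sym (ds-dart t)) refl
              λ {a} {b} ab ab∈ _ → xor-false⇒≡ (trans (δψ ab) (uncrossed-face {ks}
                ( ((λ eq → opp≢A t (trans (sym (ds∈A i)) eq)) , (λ eq → t≢i (sym (opp-injective i<K t<K eq))))
                ∷ ((λ eq → t≢i (sym (opp-injective i<K t<K (trans (sym xy∈) eq))))
                  , (λ eq → t≢j (sym (opp-injective j<K t<K (trans (sym yx∈) eq)))))
                ∷ ((λ eq → opp≢A t (trans (sym (ds∈A j)) eq)) , (λ eq → t≢j (sym (opp-injective j<K t<K eq))))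
                ∷ []) {a} {b} ab∈))

            not-reversed : ∀ {t s} → (target (ds t) , source (ds t)) ≢ ds s
            not-reversed {t} {s} eq = opp≢A s (trans (sym (ds∈A t)) (cong right eq))

            not-xy : ∀ t → ds t ≢ (x , y) × (target (ds t) , source (ds t)) ≢ (x , y)
            not-xy t = (λ eq → opp≢A i (trans (sym (ds∈A t)) (trans (cong left eq) xy∈)))
                     , (λ eq → opp≢A j (trans (sym (ds∈A t)) (trans (cong right eq) yx∈)))

            step-same : ∀ {t} → t < K → t ≢ i → t ≢ j → ψ (source (ds t)) ≡ ψ (target (ds t))
            step-same {t} t<K t≢i t≢j = xor-false⇒≡ (trans (δψ (ds-dart t)) (uncrossed ks {source (ds t)} {target (ds t)}
              ( ((λ eq → t≢i (ds-injective t<K i<K eq)) , not-reversed {t} {i})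
              ∷ not-xy t
              ∷ ((λ eq → t≢j (ds-injective t<K j<K eq)) , not-reversed {t} {j}) ∷ [])))

            -- The only crossed edges around `A` are those numbered `i` and `j`; the stretch from
            -- `p` to `j` and the one from behind `j` to `q` avoid both.
            ψp≡ψj : ψ (source (ds p)) ≡ ψ (source (ds j))
            ψp≡ψj = walk-to ψ (<⇒≤ p<j) λ p≤t t<j →
              step-same (<-trans t<j j<K) (≢-sym (<⇒≢ (<-≤-trans i<p p≤t))) (<⇒≢ t<j)

            ψj≡ψq : ψ (target (ds j)) ≡ ψ (source (ds q))
            ψj≡ψq = walk-to ψ j<q λ j<t t<q →
              step-same (<-trans t<q q<K) (≢-sym (<⇒≢ (<-trans (<-trans i<p p<j) j<t))) (≢-sym (<⇒≢ j<t))

            q≢i : q ≢ i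
            q≢i = ≢-sym (<⇒≢ (<-trans (<-trans i<p p<j) j<q))

            -- The curve does not enter `opp p` or `opp q`, and these share a vertex, so `ψ` agrees
            -- on them; but the walk along `A` from `p` to `q` crosses the curve exactly once, at
            -- `j`.
            ψp≡ψq : ψ (source (ds p)) ≡ ψ (source (ds q))
            ψp≡ψq = trans
              (constant-on p<K (≢-sym (<⇒≢ i<p)) (<⇒≢ p<j) (f-dart uv) (trans (face-next uv) uv∈))
              (sym (constant-on q<K q≢i (≢-sym (<⇒≢ j<q)) (—-sym uv) vu∈))

            ψj-crosses : ψ (source (ds j)) xor ψ (target (ds j)) ≡ true
            ψj-crosses = trans (δψ (ds-dart j)) (cong₂ _xor_
                (≢true⇒≡false λ same → [ (λ eq → <⇒≢ (<-trans i<p p<j) (sym (ds-injective j<K i<K eq)))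
                                       , not-reversed {j} {i} ]′ (sameEdge⁻ {k = ds i} {source (ds j)} {target (ds j)} same))
                (cong₂ _xor_
                  (≢true⇒≡false λ same → [ proj₁ (not-xy j) , proj₂ (not-xy j) ]′ (sameEdge⁻ {k = x , y} {source (ds j)} {target (ds j)} same))
                  (cong (_xor false) (sameEdge-refl (source (ds j)) (target (ds j))))))

            absurd : ⊥
            absurd = contradiction
              (trans (sym ψj-crosses)
                (trans (cong₂ _xor_ (trans (sym ψp≡ψj) ψp≡ψq) ψj≡ψq) (xor-same (ψ (source (ds q))))))
              λ ()

      open NonCrossing {λ s t → Touch (opp s) (opp t)} (λ s t → touch? (opp s) (opp t)) {K} noncrossing

      abstract
        -- The first and the last neighbour may touch, since the circle closes up; their prescribed
        -- colours differ.
        coloured : ∃ λ col → col 0 ≡ zero × col p₀ ≡ suc zero × Proper 0 p₀ col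
        coloured = colouring p₀ (s≤s⁻¹ 1<K) (n<1+n p₀) (m≤m+n p₀ 0) {zero} {suc zero} λ ()

    neighbour-colour : Fin m → Fin 3
    neighbour-colour B with any? (λ (t : Fin K) → opp (toℕ t) ≟ B)
    ... | yes (t , _) = proj₁ coloured (toℕ t)
    -- A dummy value: colours are compared only for faces that touch `A`.
    ... | no _        = zero

    private
      colour-at : ∀ {B} → Touch A B → ∃ λ t → t < K × opp t ≡ B × neighbour-colour B ≡ proj₁ coloured t
      colour-at {B} (u , v , uv , uv∈ , vu∈) with any? (λ (t : Fin K) → opp (toℕ t) ≟ B)
      ... | yes (t , eq) = toℕ t , toℕ<n t , eq , refl
      ... | no none with covered uv uv∈
      ...   | t , t<K , eq = contradiction
              (fromℕ< t<K , trans (cong opp (toℕ-fromℕ< t<K)) (trans (cong right eq) vu∈)) none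

    neighbour-colour-proper : ∀ {B C} → Touch A B → Touch A C → Touch B C →
                              neighbour-colour B ≢ neighbour-colour C
    neighbour-colour-proper AB AC BC eq with colour-at AB | colour-at AC
    ... | s , s<K , refl , col-s | t , t<K , refl , col-t with <-cmp s t
    ...   | tri≈ _ refl _ = touch-≢ BC refl
    ...   | tri< s<t _ _ = proj₂ (proj₂ (proj₂ coloured)) z≤n s<t (s≤s⁻¹ t<K) BC
                             (trans (sym col-s) (trans eq col-t))
    ...   | tri> _ _ t<s = proj₂ (proj₂ (proj₂ coloured)) z≤n t<s (s≤s⁻¹ s<K) (touch-sym BC)
                             (trans (sym col-t) (trans (sym eq) col-s))

  -- Double covers

  f≢ : ∀ {d} → IsDart d → d ≢ f d
  f≢ e eq = —-≢ e (cong proj₁ eq)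

  -- A return after two steps would mean turning back at a vertex, which `r≢` forbids; with `f≢`,
  -- every face has at least three edges.
  f²≢ : ∀ {d} → IsDart d → d ≢ f (f d)
  f²≢ e eq = r≢ (—-sym e) (sym (cong proj₁ eq))

  -- As `2 * m ≡ 4 + n`, having two cycles fewer than faces is exactly the bound `n/2`.
  SmallCover : Set
  SmallCover = Σ (List (Cycle G)) λ cs → IsCycleDoubleCover cs × 2 + length cs ≤ m

  module _ {A : Fin m} (free : Free A) {d₀ : Dart n} (d₀-dart : IsDart d₀) (d₀∈A : left d₀ ≡ A) where

    open Boundary free d₀-dart d₀∈A

    private
      kind : Fin m → Kind
      kind Z = if does (Z ≟ A) then centre else
               if does (touch? A Z) then ring (neighbour-colour Z) else outer

      kind-A : kind A ≡ centre
      kind-A = cong (if_then centre else (if does (touch? A A) then ring (neighbour-colour A) else outer))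
                    (dec-true (A ≟ A) refl)

      kind-ring : ∀ {Z} → Touch A Z → kind Z ≡ ring (neighbour-colour Z)
      kind-ring {Z} AZ = trans
        (cong (if_then centre else (if does (touch? A Z) then ring (neighbour-colour Z) else outer))
          (dec-false (Z ≟ A) (≢-sym (touch-≢ AZ))))
        (cong (if_then ring (neighbour-colour Z) else outer) (dec-true (touch? A Z) AZ))

      kind-outer : ∀ {Z} → Z ≢ A → ¬ Touch A Z → kind Z ≡ outer
      kind-outer {Z} Z≢A ¬AZ = trans
        (cong (if_then centre else (if does (touch? A Z) then ring (neighbour-colour Z) else outer))
          (dec-false (Z ≟ A) Z≢A))
        (cong (if_then ring (neighbour-colour Z) else outer) (dec-false (touch? A Z) ¬AZ))

      data View (Z : Fin m) : Set where
        isA    : Z ≡ A → View Z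
        isRing : Touch A Z → View Z
        isOut  : Z ≢ A → ¬ Touch A Z → View Z

      view : ∀ Z → View Z
      view Z with Z ≟ A | touch? A Z
      ... | yes Z≡A | _      = isA Z≡A
      ... | no _    | yes AZ = isRing AZ
      ... | no Z≢A  | no ¬AZ = isOut Z≢A ¬AZ

      leaves : Fin 3 → Fin m → Bool
      leaves c Z = inRing c (kind Z)

      leaf⇒ : ∀ {c Z} → leaves c Z ≡ true → Touch A Z × neighbour-colour Z ≡ c
      leaf⇒ {c} {Z} leaf with view Z
      ... | isA refl with trans (sym leaf) (cong (inRing c) kind-A)
      ...   | ()
      leaf⇒ {c} {Z} leaf | isOut Z≢A ¬AZ with trans (sym leaf) (cong (inRing c) (kind-outer Z≢A ¬AZ))
      ...   | ()
      leaf⇒ {c} {Z} leaf | isRing AZ with neighbour-colour Z ≟ c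
                                         | trans (sym (cong (inRing c) (kind-ring AZ))) leaf
      ...   | yes eq | _ = AZ , eq

      star-c : ∀ c → Star A (leaves c)
      star-c c = record
        { touches = proj₁ ∘ leaf⇒ {c}
        ; once = λ uv uv′ i i′ _ eq → free uv uv′ i i′ eq
        ; independent = λ {u} {v} uv p → ≢true⇒≡false λ q →
            neighbour-colour-proper (proj₁ (leaf⇒ {c} p)) (proj₁ (leaf⇒ {c} q)) (u , v , uv , refl , refl)
              (trans (proj₂ (leaf⇒ {c} p)) (sym (proj₂ (leaf⇒ {c} q)))) }

      -- A star without leaves; its cycle is the boundary of the face `B` alone.
      single : ∀ B → Star B (λ _ → false)
      single B = record { touches = λ () ; once = λ _ _ _ _ () ; independent = λ _ () }

      keep : Fin m → Bool
      keep Z = isOuter (kind Z)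

      cycles : List (Cycle G)
      cycles = starCycle (star-c zero) ∷ starCycle (star-c (suc zero)) ∷ starCycle (star-c (suc (suc zero)))
             ∷ collect keep (λ B → starCycle (single B))

      star-kind : ∀ c Z → star A (leaves c) Z ≡ inStar c (kind Z)
      star-kind c Z with view Z
      ... | isA refl = trans (cong (_∨ leaves c A) (dec-true (A ≟ A) refl)) (sym (cong (inStar c) kind-A))
      ... | isRing AZ = trans (cong₂ _∨_ (dec-false (Z ≟ A) (≢-sym (touch-≢ AZ))) (cong (inRing c) (kind-ring AZ)))
                              (sym (cong (inStar c) (kind-ring AZ)))
      ... | isOut Z≢A ¬AZ = trans (cong₂ _∨_ (dec-false (Z ≟ A) Z≢A) (cong (inRing c) (kind-outer Z≢A ¬AZ)))
                                  (sym (cong (inStar c) (kind-outer Z≢A ¬AZ)))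

      compatible : ∀ {u v} → u — v → Compatible (kind (face u v)) (kind (face v u))
      compatible {u} {v} uv with view (face u v) | view (face v u)
      ... | isA i | isA j = ⊥-elim (left≢right uv (trans i (sym j)))
      ... | isA i | isRing AZ rewrite i | kind-A | kind-ring AZ = tt
      ... | isA i | isOut _ ¬AZ = ⊥-elim (¬AZ (u , v , uv , i , refl))
      ... | isRing AZ | isA j rewrite j | kind-A | kind-ring AZ = tt
      ... | isRing AZ | isRing AZ′ rewrite kind-ring AZ | kind-ring AZ′ =
              neighbour-colour-proper AZ AZ′ (u , v , uv , refl , refl)
      ... | isRing AZ | isOut Z≢A ¬AZ rewrite kind-ring AZ | kind-outer Z≢A ¬AZ = tt
      ... | isOut _ ¬AZ | isA j = ⊥-elim (¬AZ (v , u , —-sym uv , j , refl))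
      ... | isOut Z≢A ¬AZ | isRing AZ rewrite kind-ring AZ | kind-outer Z≢A ¬AZ = tt
      ... | isOut Z≢A ¬AZ | isOut Z≢A′ ¬AZ′ rewrite kind-outer Z≢A ¬AZ | kind-outer Z≢A′ ¬AZ′ = tt

      covers : IsCycleDoubleCover cycles
      covers u v uvT = trans
        (cong₂ _+_ (on-star zero) (cong₂ _+_ (on-star (suc zero)) (cong₂ _+_ (on-star (suc (suc zero))) outside)))
        (multiplicity-two (kind (face u v)) (kind (face v u)) (compatible uv))
        where
        uv : u — v
        uv = T⇒≡ uvT
        on-star : ∀ c → indicator (boundary (star A (leaves c)) u v) ≡
                        indicator (inStar c (kind (face u v)) xor inStar c (kind (face v u)))
        on-star c = cong indicator (cong₂ _∧_ uv (cong₂ _xor_ (star-kind c (face u v)) (star-kind c (face v u))))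
        outside : edgeMult (collect keep (λ B → starCycle (single B))) u v ≡
                  indicator (keep (face u v)) + indicator (keep (face v u))
        outside = trans (edgeMult-collect keep (λ B → starCycle (single B)) u v)
          (trans (countF-cong (λ B → cong (keep B ∧_) (cong₂ _∧_ uv
                   (cong₂ _xor_ (∨-identityʳ (does (face u v ≟ B))) (∨-identityʳ (does (face v u ≟ B)))))))
                 (countF-pair keep (left≢right uv)))

    -- Four distinct neighbours and A itself are replaced by three cycles.
    star-cover : iter f 3 d₀ ≢ d₀ → SmallCover
    star-cover d₃≢d₀ = cycles , covers , small
      where
      d₁ = f d₀
      d₂ = f d₁
      d₃ = f d₂
      e₁ : IsDart d₁
      e₁ = f-dart d₀-dart
      e₂ : IsDart d₂
      e₂ = f-dart e₁
      e₃ : IsDart d₃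
      e₃ = f-dart e₂
      i₁ : left d₁ ≡ A
      i₁ = trans (face-iter 1 d₀-dart) d₀∈A
      i₂ : left d₂ ≡ A
      i₂ = trans (face-iter 2 d₀-dart) d₀∈A
      i₃ : left d₃ ≡ A
      i₃ = trans (face-iter 3 d₀-dart) d₀∈A
      not-A : ∀ {d} → IsDart d → left d ≡ A → A ≢ right d
      not-A e i eq = left≢right e (trans i eq)
      apart : ∀ {d d′} → IsDart d → IsDart d′ → left d ≡ A → left d′ ≡ A → d ≢ d′ → right d ≢ right d′
      apart e e′ i i′ ne eq = ne (free e e′ i i′ eq)
      five : Unique (A ∷ right d₀ ∷ right d₁ ∷ right d₂ ∷ right d₃ ∷ [])
      five = (not-A d₀-dart d₀∈A ∷ not-A e₁ i₁ ∷ not-A e₂ i₂ ∷ not-A e₃ i₃ ∷ [])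
           ∷ (apart d₀-dart e₁ d₀∈A i₁ (f≢ d₀-dart) ∷ apart d₀-dart e₂ d₀∈A i₂ (f²≢ d₀-dart)
             ∷ apart d₀-dart e₃ d₀∈A i₃ (≢-sym d₃≢d₀) ∷ [])
           ∷ (apart e₁ e₂ i₁ i₂ (f≢ e₁) ∷ apart e₁ e₃ i₁ i₃ (f²≢ e₁) ∷ [])
           ∷ (apart e₂ e₃ i₂ i₃ (f≢ e₂) ∷ []) ∷ [] ∷ []
      dropped-nbr : ∀ {d} → IsDart d → left d ≡ A → not (keep (right d)) ≡ true
      dropped-nbr {u , v} e i = cong (not ∘ isOuter) (kind-ring (u , v , e , i , refl))
      dropped : 5 ≤ countF (not ∘ keep)
      dropped = countF-unique five (cong (not ∘ isOuter) kind-A ∷ dropped-nbr d₀-dart d₀∈A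
        ∷ dropped-nbr e₁ i₁ ∷ dropped-nbr e₂ i₂ ∷ dropped-nbr e₃ i₃ ∷ [])
      small : 2 + length cycles ≤ m
      small = begin
        5 + length (collect keep (λ B → starCycle (single B)))
          ≡⟨ cong (5 +_) (length-collect keep (λ B → starCycle (single B))) ⟩
        5 + countF keep                     ≤⟨ +-monoˡ-≤ (countF keep) dropped ⟩
        countF (not ∘ keep) + countF keep   ≡⟨ +-comm (countF (not ∘ keep)) _ ⟩
        countF keep + countF (not ∘ keep)   ≡⟨ countF-not keep ⟩
        m                                   ∎
        where open ≤-Reasoning

  -- Triangular faces shared out among their neighbours

  Triangle : Fin m → Set
  Triangle X = ∀ {u v} → u — v → face u v ≡ X → iter f 3 (u , v) ≡ (u , v)

  triangle : ∀ {d} → IsDart d → iter f 3 d ≡ d → Triangle (left d)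
  triangle {d} e eq uv uv∈ with orbit e uv (sym uv∈)
  ... | k , refl = begin
    iter f 3 (iter f k d) ≡⟨ iter-+ f 3 k d ⟨
    iter f (3 + k) d      ≡⟨ cong (λ j → iter f j d) (+-comm 3 k) ⟩
    iter f (k + 3) d      ≡⟨ iter-+ f k 3 d ⟩
    iter f k (iter f 3 d) ≡⟨ cong (iter f k) eq ⟩
    iter f k d            ∎
    where open ≡-Reasoning

  triangle-neighbours : ∀ {u v} → u — v → Triangle (face u v) → ∀ {B} → Touch (face u v) B →
                        B ∈ face v u ∷ right (f (u , v)) ∷ right (f (f (u , v))) ∷ []
  triangle-neighbours {u} {v} uv tri (x , y , xy , xy∈ , refl) with orbit uv xy (sym xy∈)
  ... | k , eq with k % 3 | m%n<n k 3 | trans (iter-% {f = f} {p = 2} (tri uv refl) k) eq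
  ...   | 0 | _ | refl = here refl
  ...   | 1 | _ | refl = there (here refl)
  ...   | 2 | _ | refl = there (there (here refl))
  ...   | suc (suc (suc _)) | s≤s (s≤s (s≤s ())) | _

  module _ {leaf : Fin m → Bool} (leaf-free : ∀ {X} → leaf X ≡ true → Free X)
    (leaf-triangle : ∀ {X} → leaf X ≡ true → Triangle X)
    (leaf-apart : ∀ {X X′} → leaf X ≡ true → leaf X′ ≡ true → ¬ Touch X X′) where

    private
      -- The triangles added to `B`. Each triangle is added to all three of its neighbours and is
      -- itself dropped from the cover.
      leaves : Fin m → Fin m → Bool
      leaves B Z = leaf Z ∧ does (touch? Z B)

      leaves⇒touch : ∀ {B Z} → leaves B Z ≡ true → Touch Z B
      leaves⇒touch {B} {Z} eq with touch? Z B | ∧-conicalʳ (leaf Z) _ eq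
      ... | yes ZB | _ = ZB

      leaf-star : ∀ B → Star B (leaves B)
      leaf-star B = record
        { touches = touch-sym ∘ leaves⇒touch
        ; once = λ uv uv′ i i′ p eq → cong₂ _,_
            (cong proj₂ (same uv uv′ i i′ p eq)) (cong proj₁ (same uv uv′ i i′ p eq))
        ; independent = λ {u} {v} uv p → ≢true⇒≡false λ q →
            leaf-apart (∧-conicalˡ _ _ p) (∧-conicalˡ _ _ q) (u , v , uv , refl , refl) }
        where
        same : ∀ {u v u′ v′} → u — v → u′ — v′ → face u v ≡ B → face u′ v′ ≡ B →
               leaves B (face v u) ≡ true → face v u ≡ face v′ u′ → (v , u) ≡ (v′ , u′)
        same uv uv′ i i′ p eq =
          leaf-free (∧-conicalˡ _ _ p) (—-sym uv) (—-sym uv′) refl (sym eq) (trans i (sym i′))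

      keep : Fin m → Bool
      keep = not ∘ leaf

      member : Fin m → Fin m → Bool
      member B = star B (leaves B)

      member-other : ∀ {Z} → leaf Z ≡ false → ∀ B → member B Z ≡ does (Z ≟ B)
      member-other {Z} ¬leaf B =
        trans (cong (λ b → does (Z ≟ B) ∨ (b ∧ does (touch? Z B))) ¬leaf) (∨-identityʳ _)

      member-leaf : ∀ {Z B} → leaf Z ≡ true → Z ≢ B → member B Z ≡ does (touch? Z B)
      member-leaf {Z} {B} isLeaf Z≢B =
        cong₂ (λ b b′ → b ∨ (b′ ∧ does (touch? Z B))) (dec-false (Z ≟ B) Z≢B) isLeaf

      count : Fin n → Fin n → ℕ
      count u v = countF (λ B → keep B ∧ boundary (member B) u v)

      count-sym : ∀ u v → count u v ≡ count v u
      count-sym u v = countF-cong λ B → cong (keep B ∧_) (boundary-sym (member B) u v)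

      count-plain : ∀ {u v} → u — v → leaf (face u v) ≡ false → leaf (face v u) ≡ false → count u v ≡ 2
      count-plain {u} {v} uv p q = trans
        (countF-cong λ B → cong (keep B ∧_) (cong₂ _∧_ uv (cong₂ _xor_ (member-other p B) (member-other q B))))
        (trans (countF-pair keep (left≢right uv))
               (cong₂ (λ s t → indicator (not s) + indicator (not t)) p q))

      -- The edge between a triangle and one neighbour becomes inner to the cycle of that neighbour,
      -- but the triangle is added to its two other neighbours as well, and both of their cycles run
      -- along this edge. Freeness makes the three neighbours distinct.
      count-leaf : ∀ {u v} → u — v → leaf (face u v) ≡ true → count u v ≡ 2
      count-leaf {u} {v} uv p = countF-exact {xs = right d₁ ∷ right d₂ ∷ []}
          ((apart e₁ e₂ i₁ i₂ (f≢ e₁) ∷ []) ∷ [] ∷ []) only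
          (counted e₁ i₁ (apart uv e₁ refl i₁ (f≢ uv)) ∷ counted e₂ i₂ (apart uv e₂ refl i₂ (f²≢ uv)) ∷ [])
        where
        X = face u v
        d₁ = f (u , v)
        d₂ = f d₁
        e₁ : IsDart d₁
        e₁ = f-dart uv
        e₂ : IsDart d₂
        e₂ = f-dart e₁
        i₁ : left d₁ ≡ X
        i₁ = face-iter 1 uv
        i₂ : left d₂ ≡ X
        i₂ = face-iter 2 uv
        apart : ∀ {d d′} → IsDart d → IsDart d′ → left d ≡ X → left d′ ≡ X → d ≢ d′ → right d ≢ right d′
        apart e e′ i i′ ne eq = ne (leaf-free p e e′ i i′ eq)
        touching : ∀ {d} → IsDart d → left d ≡ X → Touch X (right d)
        touching {x , y} e i = x , y , e , i , refl
        other : leaf (face v u) ≡ false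
        other = ≢true⇒≡false λ q → leaf-apart p q (u , v , uv , refl , refl)
        crossing : ∀ {B} → X ≢ B → boundary (member B) u v ≡ does (touch? X B) xor does (face v u ≟ B)
        crossing {B} X≢B = cong₂ _∧_ uv (cong₂ _xor_ (member-leaf p X≢B) (member-other other B))
        counted : ∀ {d} → IsDart d → left d ≡ X → face v u ≢ right d →
                  keep (right d) ∧ boundary (member (right d)) u v ≡ true
        counted {d} e i ne = cong₂ _∧_
          (cong not (≢true⇒≡false λ q → leaf-apart p q (touching e i)))
          (trans (crossing (touch-≢ (touching e i)))
                 (cong₂ _xor_ (dec-true (touch? X (right d)) (touching e i)) (dec-false (face v u ≟ right d) ne)))
        only : ∀ B → keep B ∧ boundary (member B) u v ≡ true → B ∈ right d₁ ∷ right d₂ ∷ []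
        only B eq = cases (X ≟ B)
          where
          neighbours : (t : Dec (Touch X B)) (w : Dec (face v u ≡ B)) → does t xor does w ≡ true →
                       B ∈ right d₁ ∷ right d₂ ∷ []
          neighbours (yes XB) (no ne) _ with triangle-neighbours uv (leaf-triangle p) XB
          ... | here B≡  = contradiction (sym B≡) ne
          ... | there B∈ = B∈
          neighbours (no ¬XB) (yes vu∈) _ = contradiction (u , v , uv , refl , vu∈) ¬XB
          cases : Dec (X ≡ B) → B ∈ right d₁ ∷ right d₂ ∷ []
          cases (yes X≡B) = contradiction
            (trans (sym (∧-conicalˡ _ _ eq)) (cong not (trans (cong leaf (sym X≡B)) p))) λ ()
          cases (no X≢B)  = neighbours (touch? X B) (face v u ≟ B)
            (trans (sym (crossing X≢B)) (∧-conicalʳ (keep B) _ eq))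

      cycles : List (Cycle G)
      cycles = collect keep (λ B → starCycle (leaf-star B))

      covers : IsCycleDoubleCover cycles
      covers u v uvT = trans (edgeMult-collect keep (λ B → starCycle (leaf-star B)) u v) two
        where
        uv : u — v
        uv = T⇒≡ uvT
        two : count u v ≡ 2
        two with true-or-false (leaf (face u v)) | true-or-false (leaf (face v u))
        ... | inj₁ p | _      = count-leaf uv p
        ... | inj₂ p | inj₁ q = trans (count-sym u v) (count-leaf (—-sym uv) q)
        ... | inj₂ p | inj₂ q = count-plain uv p q

    leaf-cover : 2 ≤ countF leaf → SmallCover
    leaf-cover two = cycles , covers , (begin
      2 + length cycles             ≡⟨ cong (2 +_) (length-collect keep (λ B → starCycle (leaf-star B))) ⟩
      2 + countF keep               ≤⟨ +-monoˡ-≤ (countF keep) two ⟩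
      countF leaf + countF keep     ≡⟨ countF-not leaf ⟩
      m                             ∎)
      where open ≤-Reasoning

  -- Touching faces share a vertex, so `Disjoint` makes the triangles distinct and non-adjacent;
  -- dropping each saves one cycle.
  two-triangles : ∀ {X X′} → Free X → Free X′ → Disjoint X X′ → Triangle X → Triangle X′ → SmallCover
  two-triangles {X} {X′} fX fX′ disjoint tX tX′ =
    leaf-cover {leaf} (λ p → free (leaf⁻ p)) (λ p → tri (leaf⁻ p)) (λ p q → apart (leaf⁻ p) (leaf⁻ q))
               (countF-unique {xs = X ∷ X′ ∷ []} ((X≢X′ ∷ []) ∷ [] ∷ [])
                 (cong (_∨ does (X ≟ X′)) (dec-true (X ≟ X) refl)
                 ∷ trans (cong (does (X′ ≟ X) ∨_) (dec-true (X′ ≟ X′) refl)) (∨-zeroʳ _) ∷ []))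
    where
    leaf : Fin m → Bool
    leaf Z = does (Z ≟ X) ∨ does (Z ≟ X′)
    leaf⁻ : ∀ {Z} → leaf Z ≡ true → Z ≡ X ⊎ Z ≡ X′
    leaf⁻ {Z} eq with Z ≟ X | Z ≟ X′
    ... | yes Z≡X | _        = inj₁ Z≡X
    ... | no _    | yes Z≡X′ = inj₂ Z≡X′
    free : ∀ {Z} → Z ≡ X ⊎ Z ≡ X′ → Free Z
    free (inj₁ refl) = fX
    free (inj₂ refl) = fX′
    tri : ∀ {Z} → Z ≡ X ⊎ Z ≡ X′ → Triangle Z
    tri (inj₁ refl) = tX
    tri (inj₂ refl) = tX′
    X≢X′ : X ≢ X′
    X≢X′ refl with dart X
    ... | u , v , uv , uv∈ = disjoint uv uv uv∈ uv∈
    not-touching : ¬ Touch X X′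
    not-touching XX′ with touch-common-vertex XX′
    ... | u , v , v′ , uv , uv′ , i , i′ = disjoint uv uv′ i i′
    apart : ∀ {Z Z′} → Z ≡ X ⊎ Z ≡ X′ → Z′ ≡ X ⊎ Z′ ≡ X′ → ¬ Touch Z Z′
    apart (inj₁ refl) (inj₁ refl) t = touch-≢ t refl
    apart (inj₁ refl) (inj₂ refl) t = not-touching t
    apart (inj₂ refl) (inj₁ refl) t = not-touching (touch-sym t)
    apart (inj₂ refl) (inj₂ refl) t = touch-≢ t refl

  -- If all faces are triangles, a vertex and its neighbours form a K₄.
  non-triangle : 4 < n → ∃₂ λ u v → u — v × iter f 3 (u , v) ≢ (u , v)
  non-triangle 4<n with any? (λ u → any? (λ v → (adj G u v ≟ᵇ true) ×-dec ¬? (iter f 3 (u , v) ≟ᵈ (u , v))))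
  ... | yes found = found
  ... | no none = ⊥-elim (<-irrefl (sym n≡4) 4<n)
    where
    all-triangles : ∀ {u v} → u — v → iter f 3 (u , v) ≡ (u , v)
    all-triangles {u} {v} uv with iter f 3 (u , v) ≟ᵈ (u , v)
    ... | yes eq = eq
    ... | no ne  = contradiction (u , v , uv , ne) none
    -- The face at the corner between two consecutive neighbours of `v` is a triangle, and its third
    -- edge joins them.
    chord : ∀ {v u} → v — u → r v u — u
    chord {v} {u} vu = subst (r v u —_) (cong proj₁ (all-triangles (—-sym vu))) (r— (—-sym (r— vu)))
    v a b c : Fin n
    v = origin
    a = proj₁ (neighbour v)
    b = r v a
    c = r v b
    va : v — a
    va = proj₂ (neighbour v)
    vb : v — b
    vb = r— va
    vc : v — c
    vc = r— vb
    ba : b — a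
    ba = chord va
    cb : c — b
    cb = chord vb
    ac : a — c
    ac = subst (_— c) (r³≡ va) (chord vc)
    a≢b = —-≢ (—-sym ba)
    a≢c = —-≢ ac
    b≢c = —-≢ (—-sym cb)
    K₄ : List (Fin n)
    K₄ = v ∷ a ∷ b ∷ c ∷ []
    K₄-unique : Unique K₄
    K₄-unique = (—-≢ va ∷ —-≢ vb ∷ —-≢ vc ∷ []) ∷ (a≢b ∷ a≢c ∷ []) ∷ (b≢c ∷ []) ∷ [] ∷ []
    saturated : ∀ {u x y z w} → Unique (x ∷ y ∷ z ∷ []) → u — x → u — y → u — z → u — w → w ∈ x ∷ y ∷ z ∷ []
    saturated {u} {x} {y} {z} {w} uniq ux uy uz uw with _∈?_ _≟_ w (x ∷ y ∷ z ∷ [])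
    ... | yes w∈ = w∈
    ... | no w∉ = ⊥-elim (<-irrefl refl (subst (4 ≤_) (cubic u)
          (countF-unique (All.tabulate (λ { y∈ refl → w∉ y∈ }) ∷ uniq) (uw ∷ ux ∷ uy ∷ uz ∷ []))))
    closed : ∀ {u w} → u — w → u ∈ K₄ → w ∈ K₄
    closed uw (here refl) =
      there (saturated ((a≢b ∷ a≢c ∷ []) ∷ (b≢c ∷ []) ∷ [] ∷ []) va vb vc uw)
    closed uw (there (here refl))
      with saturated ((—-≢ vb ∷ —-≢ vc ∷ []) ∷ (b≢c ∷ []) ∷ [] ∷ []) (—-sym va) (—-sym ba) ac uw
    ... | here eq  = here eq
    ... | there w∈ = there (there w∈)
    closed uw (there (there (here refl)))
      with saturated ((—-≢ va ∷ —-≢ vc ∷ []) ∷ (a≢c ∷ []) ∷ [] ∷ []) (—-sym vb) ba (—-sym cb) uw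
    ... | here eq                 = here eq
    ... | there (here eq)         = there (here eq)
    ... | there (there (here eq)) = there (there (there (here eq)))
    closed uw (there (there (there (here refl))))
      with saturated ((—-≢ va ∷ —-≢ vb ∷ []) ∷ (a≢b ∷ []) ∷ [] ∷ []) (—-sym vc) (—-sym ac) cb uw
    ... | here eq                 = here eq
    ... | there (here eq)         = there (here eq)
    ... | there (there (here eq)) = there (there (here eq))
    -- The four vertices have no neighbours outside, so membership is invariant along edges and
    -- connectedness extends it to every vertex.
    inside : Fin n → Bool
    inside w = does (_∈?_ _≟_ w K₄)
    inside-invariant : ∀ {u w} → u — w → inside u ≡ inside w
    inside-invariant {u} {w} uw =
      does-⇔ (mk⇔ (closed uw) (closed (—-sym uw))) (_∈?_ _≟_ u K₄) (_∈?_ _≟_ w K₄)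
    does⁻ : ∀ {P : Set} (P? : Dec P) → does P? ≡ true → P
    does⁻ (yes p) _ = p
    everything : ∀ w → w ∈ K₄
    everything w = does⁻ (_∈?_ _≟_ w K₄)
      (trans (connected inside inside-invariant w v) (dec-true (_∈?_ _≟_ v K₄) (here refl)))
    n≡4 : n ≡ 4
    n≡4 = trans (sym (trans (sumF-const n 1) (*-identityʳ n)))
                (countF-exact {p = λ _ → true} K₄-unique (λ w _ → everything w) (refl ∷ refl ∷ refl ∷ refl ∷ []))

  -- Choosing the construction and deriving the bound

  small-cover : 4 < n → SmallCover
  small-cover 4<n = [ no-digon , digon ]′ (all-or (λ A → [ inj₁ , inj₂ ∘ proj₁ ]′ (free-or-digon A)))
    where
    no-digon : (∀ A → Free A) → SmallCover
    no-digon all-free = long (non-triangle 4<n)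
      where
      long : (∃₂ λ u v → u — v × iter f 3 (u , v) ≢ (u , v)) → SmallCover
      long (u , v , uv , ne) = star-cover {face u v} (all-free (face u v)) {u , v} uv refl ne
    digon : Digon → SmallCover
    digon D = two-faces (two-free-faces D)
      where
      two-faces : (∃₂ λ X X′ → Free X × Free X′ × Disjoint X X′) → SmallCover
      two-faces (X , X′ , fX , fX′ , disjoint) = with-darts (dart X) (dart X′)
        where
        with-darts : (∃₂ λ u v → u — v × face u v ≡ X) → (∃₂ λ u v → u — v × face u v ≡ X′) → SmallCover
        with-darts (u , v , uv , uv∈) (u′ , v′ , uv′ , uv∈′) =
          cases (iter f 3 (u , v) ≟ᵈ (u , v)) (iter f 3 (u′ , v′) ≟ᵈ (u′ , v′))
          where
          cases : Dec (iter f 3 (u , v) ≡ (u , v)) → Dec (iter f 3 (u′ , v′) ≡ (u′ , v′)) → SmallCover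
          cases (no ne)  _         = star-cover {X} fX {u , v} uv uv∈ ne
          cases (yes _)  (no ne)   = star-cover {X′} fX′ {u′ , v′} uv′ uv∈′ ne
          cases (yes eq) (yes eq′) = two-triangles fX fX′ disjoint
            (subst Triangle uv∈ (triangle {u , v} uv eq)) (subst Triangle uv∈′ (triangle {u′ , v′} uv′ eq′))

  -- Twice Euler's formula, in which twice the number of edges is `n * 3`.
  twice-faces : 2 * m ≡ 4 + n
  twice-faces = +-cancelˡ-≡ (n + n) (2 * m) (4 + n) (begin
    n + n + 2 * m                       ≡⟨ regroup n m ⟩
    (n + m) + (n + m)                   ≡⟨ cong₂ _+_ euler euler ⟩
    (2 + numEdges G) + (2 + numEdges G) ≡⟨ regroup′ (numEdges G) ⟩
    4 + (numEdges G + numEdges G)       ≡⟨ cong (4 +_) (handshake G cubic) ⟩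
    4 + n * 3                           ≡⟨ regroup″ n ⟩
    n + n + (4 + n)                     ∎)
    where
    open ≡-Reasoning
    regroup : ∀ n F → n + n + 2 * F ≡ (n + F) + (n + F)
    regroup = solve-∀
    regroup′ : ∀ e → (2 + e) + (2 + e) ≡ 4 + (e + e)
    regroup′ = solve-∀
    regroup″ : ∀ n → 4 + n * 3 ≡ n + n + (4 + n)
    regroup″ = solve-∀

  half-cover : SmallCover → Σ (List (Cycle G)) (λ cs → IsCycleDoubleCover cs × 2 * length cs ≤ n)
  half-cover (cs , covers , small) = cs , covers , +-cancelˡ-≤ 4 (2 * length cs) n (begin
    4 + 2 * length cs   ≡⟨ *-distribˡ-+ 2 2 (length cs) ⟨
    2 * (2 + length cs) ≤⟨ *-monoʳ-≤ 2 small ⟩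
    2 * m               ≡⟨ twice-faces ⟩
    4 + n               ∎)
    where open ≤-Reasoning

theorem4 : (n : ℕ) (G : SimpleGraph n) → 4 < n → Planar G → TwoConnected G → Cubic G →
    Σ (List (Cycle G)) (λ cs → IsCycleDoubleCover cs × 2 * length cs ≤ n)
theorem4 n G 4<n (R , euler) conn cubic = from-faces (faces G R cubic (fromℕ< 4<n))
  where
  from-faces : Faces G R → Σ (List (Cycle G)) (λ cs → IsCycleDoubleCover cs × 2 * length cs ≤ n)
  from-faces Φ = half-cover (small-cover 4<n)
    where
    open Sphere G R cubic (fromℕ< 4<n) Φ (trans (cong (n +_) (Faces.m≡numFaces Φ)) euler)
      (invariant⇒constant G conn) (proj₂ conn)
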